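{- Let $K\subset L$ be an extension of fields (possibly skew), with $K$ commutative and central in $L$. Let $B$ be a finite-dimensional $K$-subspace of $L$. Then $B$ is matched to itself if and only if $1\notin B$.
   Context: "Field" means a division ring (skew field). $K$ is central in $L$ if $\lambda x=x\lambda$ for all $\lambda\in K$, $x\in L$. Let $A,B$ be $n$-dimensional $K$-subspaces of $L$, with (indexed) bases $\mathcal{A}=\{a_1,\ldots,a_n\}$ of $A$ and $\mathcal{B}=\{b_1,\ldots,b_n\}$ of $B$. We say that $\mathcal{A}$ is matched to $\mathcal{B}$ if for all $i=1,\ldots,n$ and all $b\in B$: $a_ib\in A$ implies $b\in\langle b_1,\ldots,\widehat{b_i},\ldots,b_n\rangle$; equivalently, $a_i^{ -1}A\cap B\subset\langle b_1,\ldots,\widehat{b_i},\ldots,b_n\rangle$ for all $i$. Here $\langle b_1,\ldots,\widehat{b_i},\ldots,b_n\rangle$ is the $K$-subspace spanned by the $b_j$ with $j\neq i$. We say that $A$ is matched to $B$ if every basis $\mathcal{A}$ of $A$ can be matched to some basis $\mathcal{B}$ of $B$ (i.e. for every basis $\mathcal{A}$ of $A$ there exists a basis $\mathcal{B}$ of $B$ such that $\mathcal{A}$ is matched to $\mathcal{B}$). "$B$ is matched to itself" is the case $A=B$. -}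

module Defs where

open import Level using (Level; _⊔_; suc)
open import Algebra.Bundles using (Ring; CommutativeRing)
open import Algebra.Definitions using (Invertible)
open import Algebra.Definitions.RawMonoid using (sum)
open import Algebra.Module.Bundles using (LeftModule)
open import Algebra.Morphism.Structures using (module RingMorphisms)
open import Data.Fin.Base using (Fin)
open import Data.Nat.Base as ℕ using (ℕ; pred)
open import Data.Product.Base using (Σ-syntax; ∃-syntax; _×_)
open import Data.Vec.Functional using (Vector; removeAt)
open import Relation.Binary.Definitions using (_Respects_)
open import Relation.Nullary.Negation.Core using (¬_)
open import Relation.Unary using (Pred; _∈_)

private
  variable
    a k ℓk l ℓl r ℓr m ℓm p : Level
    A : Set a
    n : ℕ

record IsDivisionRing (R : Ring r ℓr) : Set (r ⊔ ℓr) where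
  open Ring R
  field
    1≉0     : ¬ (1# ≈ 0#)
    inverse : ∀ x → ¬ (x ≈ 0#) → Invertible _≈_ 1# _*_ x

-- The family (b₁, …, b̂ᵢ, …, bₙ).
omit : Vector A n → Fin n → Vector A (pred n)
omit {n = ℕ.suc _} b i = removeAt b i

module LinearAlgebra {R : Ring r ℓr} (V : LeftModule R m ℓm) where

  open Ring R using (Carrier; _≈_; 0#)
  open LeftModule V

  linearCombination : Vector Carrier n → Vector Carrierᴹ n → Carrierᴹ
  linearCombination c v = sum +ᴹ-rawMonoid (λ i → c i *ₗ v i)

  Span : Vector Carrierᴹ n → Pred Carrierᴹ (r ⊔ ℓm)
  Span {n} v x = Σ[ c ∈ Vector Carrier n ] (x ≈ᴹ linearCombination c v)

  LinearlyIndependent : Vector Carrierᴹ n → Set (r ⊔ ℓr ⊔ ℓm)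
  LinearlyIndependent {n} v =
    (c : Vector Carrier n) → linearCombination c v ≈ᴹ 0ᴹ → ∀ i → c i ≈ 0#

  record Subspace p : Set (r ⊔ m ⊔ ℓm ⊔ suc p) where
    field
      member    : Pred Carrierᴹ p
      resp      : member Respects _≈ᴹ_
      0-closed  : 0ᴹ ∈ member
      +-closed  : ∀ {x y} → x ∈ member → y ∈ member → (x +ᴹ y) ∈ member
      *ₗ-closed : ∀ c {x} → x ∈ member → (c *ₗ x) ∈ member

  open Subspace public using (member)

  record IsBasis (W : Subspace p) (v : Vector Carrierᴹ n)
                 : Set (r ⊔ ℓr ⊔ m ⊔ ℓm ⊔ p) where
    field
      inSubspace  : ∀ i → v i ∈ member W
      independent : LinearlyIndependent v
      spanning    : ∀ {x} → x ∈ member W → x ∈ Span v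

  HasDimension : Subspace p → ℕ → Set (r ⊔ ℓr ⊔ m ⊔ ℓm ⊔ p)
  HasDimension W n = ∃[ v ] IsBasis {n = n} W v

-- The inclusion K ⊂ L is given by an injective ring homomorphism ι.
record CentralExtension (K : CommutativeRing k ℓk) (L : Ring l ℓl)
                        : Set (k ⊔ ℓk ⊔ l ⊔ ℓl) where
  private
    module K = CommutativeRing K
  open Ring L
  open RingMorphisms K.rawRing rawRing using (IsRingMonomorphism)
  field
    K-isDivisionRing   : IsDivisionRing K.ring
    L-isDivisionRing   : IsDivisionRing L
    ι                  : K.Carrier → Carrier
    ι-isMonomorphism   : IsRingMonomorphism ι
    ι-central          : ∀ c x → ι c * x ≈ x * ι c

  open IsRingMonomorphism ι-isMonomorphism

  leftModule : LeftModule K.ring l ℓl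
  leftModule = record
    { Carrierᴹ = Carrier
    ; _≈ᴹ_ = _≈_
    ; _+ᴹ_ = _+_
    ; _*ₗ_ = λ c x → ι c * x
    ; 0ᴹ = 0#
    ; -ᴹ_ = -_
    ; isLeftModule = record
      { isLeftSemimodule = record
        { +ᴹ-isCommutativeMonoid = +-isCommutativeMonoid
        ; isPreleftSemimodule = record
          { *ₗ-cong = λ c≈d x≈y → *-cong (⟦⟧-cong c≈d) x≈y
          ; *ₗ-zeroˡ = λ x → trans (*-congʳ 0#-homo) (zeroˡ x)
          ; *ₗ-distribʳ = λ x c d → trans (*-congʳ (+-homo c d)) (distribʳ x (ι c) (ι d))
          ; *ₗ-identityˡ = λ x → trans (*-congʳ 1#-homo) (*-identityˡ x)
          ; *ₗ-assoc = λ c d x → trans (*-congʳ (*-homo c d)) (*-assoc (ι c) (ι d) x)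
          ; *ₗ-zeroʳ = λ c → zeroʳ (ι c)
          ; *ₗ-distribˡ = λ c → distribˡ (ι c)
          }
        }
      ; -ᴹ‿cong = -‿cong
      ; -ᴹ‿inverse = -‿inverse
      }
    }

module Matching {K : CommutativeRing k ℓk} {L : Ring l ℓl}
                (E : CentralExtension K L) where

  open Ring L using (Carrier; _*_)
  open LinearAlgebra (CentralExtension.leftModule E) public

  BasisMatched : (A B : Subspace p) → (a b : Vector Carrier n) → Set (k ⊔ l ⊔ ℓl ⊔ p)
  BasisMatched A B a b =
    ∀ i {x} → x ∈ member B → (a i * x) ∈ member A → x ∈ Span (omit b i)

  -- For A and B of the same dimension n.
  Matched : ℕ → (A B : Subspace p) → Set (k ⊔ ℓk ⊔ l ⊔ ℓl ⊔ p)
  Matched n A B =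
    (a : Vector Carrier n) → IsBasis A a →
    ∃[ b ] (IsBasis B b × BasisMatched A B a b)

{-# OPTIONS --safe #-}
module Submission where

-- Suppose 1 ∉ B. A basis a of B is matched to b as soon as b is dual to independent hyperplanes
-- Hᵢ ⊇ Vᵢ := { x ∈ B ∣ aᵢ x ∈ B }, and by the dual form of Rado's theorem such hyperplanes exist iff
-- dim ⋂_{i ∈ J} Vᵢ ≤ n − |J| for all J. With A = ⟨ aᵢ : i ∈ J ⟩ and C = ⋂_{i ∈ J} Vᵢ one has A C ⊆ B, so
-- this follows from dim A + dim C ≤ dim B, a linear analogue of a theorem of Kemperman and Scherk on
-- subspaces A, C with A, C, A C ⊆ B ∌ 1. If A ∩ C = 0 the bound is clear; otherwise, for 0 ≠ e ∈ A ∩ C,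
-- both (A + A e, C ∩ e⁻¹ C) and (A ∩ A e⁻¹, C + e C) satisfy the same hypotheses, their dimension sums
-- average to at least dim A + dim C, and C ∩ e⁻¹ C ≠ C because e C = C would give 1 ∈ C, so a
-- descent reaches the first case.
-- Conversely, 1 ∈ B and aᵢ 1 ∈ B put 1 into every ⟨ bⱼ : j ≠ i ⟩, so all its coordinates vanish.

open import Defs
open import Level using (Level; _⊔_; Lift; lift; lower)
open import Algebra.Bundles using (CommutativeMonoid; Ring; CommutativeRing)
open import Algebra.Module.Bundles using (LeftModule)
open import Algebra.Module.Morphism.Structures using (module LeftModuleMorphisms)
import Algebra.Module.Properties.LeftModule as LeftModuleProperties
import Algebra.Properties.CommutativeMonoid.Sum as CommutativeMonoidSum
import Algebra.Properties.CommutativeSemigroup as CommutativeSemigroupProperties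
import Algebra.Properties.Ring as RingProperties
open import Axiom.ExcludedMiddle using (ExcludedMiddle)
open import Data.Fin.Base using (Fin; zero; suc; punchIn; punchOut)
open import Data.Fin.Properties as Fin using (punchInᵢ≢i; punchIn-punchOut)
open import Data.Fin.Subset as Subset using (Subset; inside; outside; ∣_∣; _∪_; _∩_)
open import Data.Fin.Subset.Properties using (anySubset?; p─⊥≡p; ∣⊤∣≡n; x∈p∩q⁻; x∈p∪q⁻; p─q⊆p)
  renaming (_∈?_ to _∈ₛ?_)
open import Data.List.Base using (List; []; _∷_; _++_; allFin; length; map; tabulate)
open import Data.List.Properties using (++-assoc; ++-identityʳ; length-++; length-map; length-tabulate)
open import Data.List.Relation.Unary.All as All using (All; []; _∷_)
import Data.List.Relation.Unary.All.Properties as All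
open import Data.Nat.Base as ℕ using (ℕ; zero; suc; _≤_; _<_; z≤n; s≤s)
import Data.Nat.Properties as ℕ
open import Data.Product.Base using (Σ-syntax; ∃-syntax; _×_; _,_; proj₁; proj₂)
open import Data.Sum.Base using (_⊎_; inj₁; inj₂)
open import Data.Unit.Polymorphic.Base using (⊤; tt)
import Data.Vec.Base as Vec
open import Data.Vec.Functional as Vector using (Vector; insertAt; removeAt; updateAt)
open import Data.Vec.Functional.Properties
  using (insertAt-lookup; insertAt-punchIn; updateAt-updates; updateAt-minimal)
open import Function.Base using (_∘_; const)
open import Function.Bundles using (_⇔_; mk⇔)
open import Relation.Binary.PropositionalEquality as ≡ using (_≡_; _≢_)
import Relation.Binary.Reasoning.Setoid as SetoidReasoning
open import Relation.Nullary.Decidable.Core using (Dec; yes; no; map′)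
open import Relation.Nullary.Negation.Core using (¬_; contradiction)
open import Relation.Unary using (Pred; _∈_; _∉_; _⊆_)

-- Cardinalities of index sets, and the arithmetic of uncrossing.

∣p∪q∣+∣p∩q∣≡∣p∣+∣q∣ : ∀ {n} (p q : Subset n) → ∣ p ∪ q ∣ ℕ.+ ∣ p ∩ q ∣ ≡ ∣ p ∣ ℕ.+ ∣ q ∣
∣p∪q∣+∣p∩q∣≡∣p∣+∣q∣ Vec.[] Vec.[] = ≡.refl
∣p∪q∣+∣p∩q∣≡∣p∣+∣q∣ (outside Vec.∷ p) (outside Vec.∷ q) = ∣p∪q∣+∣p∩q∣≡∣p∣+∣q∣ p q
∣p∪q∣+∣p∩q∣≡∣p∣+∣q∣ (outside Vec.∷ p) (inside  Vec.∷ q) =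
  ≡.trans (≡.cong suc (∣p∪q∣+∣p∩q∣≡∣p∣+∣q∣ p q)) (≡.sym (ℕ.+-suc ∣ p ∣ ∣ q ∣))
∣p∪q∣+∣p∩q∣≡∣p∣+∣q∣ (inside  Vec.∷ p) (outside Vec.∷ q) = ≡.cong suc (∣p∪q∣+∣p∩q∣≡∣p∣+∣q∣ p q)
∣p∪q∣+∣p∩q∣≡∣p∣+∣q∣ (inside  Vec.∷ p) (inside  Vec.∷ q) = ≡.cong suc (begin
  ∣ p ∪ q ∣ ℕ.+ suc ∣ p ∩ q ∣   ≡⟨ ℕ.+-suc _ _ ⟩
  suc (∣ p ∪ q ∣ ℕ.+ ∣ p ∩ q ∣) ≡⟨ ≡.cong suc (∣p∪q∣+∣p∩q∣≡∣p∣+∣q∣ p q) ⟩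
  suc (∣ p ∣ ℕ.+ ∣ q ∣)         ≡⟨ ℕ.+-suc _ _ ⟨
  ∣ p ∣ ℕ.+ suc ∣ q ∣           ∎)
  where open ≡.≡-Reasoning

∣p∣≤1+∣p-x∣ : ∀ {n} (p : Subset n) x → ∣ p ∣ ≤ suc ∣ p Subset.- x ∣
∣p∣≤1+∣p-x∣ (outside Vec.∷ p) zero    = ℕ.m≤n⇒m≤1+n (ℕ.≤-reflexive (≡.cong ∣_∣ (≡.sym (p─⊥≡p p))))
∣p∣≤1+∣p-x∣ (inside  Vec.∷ p) zero    = s≤s (ℕ.≤-reflexive (≡.cong ∣_∣ (≡.sym (p─⊥≡p p))))
∣p∣≤1+∣p-x∣ (outside Vec.∷ p) (suc x) = ∣p∣≤1+∣p-x∣ p x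
∣p∣≤1+∣p-x∣ (inside  Vec.∷ p) (suc x) = s≤s (∣p∣≤1+∣p-x∣ p x)

x∉p-x : ∀ {n} (p : Subset n) x → x Subset.∉ p Subset.- x
x∉p-x (_       Vec.∷ p) (suc x) (Vec.there x∈) = x∉p-x p x x∈

-- The two strict bounds add up to at least `2b + 2`, while submodularity and the two bounds by `b`
-- leave at most `2b + 1`, the extra one coming from `k∩ ≤ suc k`. The hypotheses are contradictory,
-- so any `A` follows.
uncrossing-count : ∀ {a} {A : Set a} {b p q s t j j′ k k∪ k∩ : ℕ} →
  b < p ℕ.+ j → b < q ℕ.+ j′ → p ℕ.+ q ≤ s ℕ.+ t → k∪ ℕ.+ k∩ ≡ j ℕ.+ j′ → k∩ ≤ suc k →
  s ℕ.+ k ≤ b → t ℕ.+ k∪ ≤ b → A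
uncrossing-count {b = b} {p} {q} {s} {t} {j} {j′} {k} {k∪} {k∩} b<p+j b<q+j′ sub k∪+k∩ k∩≤ s+k≤b t+k∪≤b =
  contradiction (ℕ.+-mono-≤ b<p+j b<q+j′) (ℕ.<⇒≱ (begin-strict
    (p ℕ.+ j) ℕ.+ (q ℕ.+ j′)   ≡⟨ interchange p j q j′ ⟩
    (p ℕ.+ q) ℕ.+ (j ℕ.+ j′)   ≤⟨ ℕ.+-monoˡ-≤ _ sub ⟩
    (s ℕ.+ t) ℕ.+ (j ℕ.+ j′)   ≡⟨ ≡.cong (s ℕ.+ t ℕ.+_) (≡.trans (≡.sym k∪+k∩) (ℕ.+-comm k∪ k∩)) ⟩
    (s ℕ.+ t) ℕ.+ (k∩ ℕ.+ k∪)  ≡⟨ interchange s t k∩ k∪ ⟩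
    (s ℕ.+ k∩) ℕ.+ (t ℕ.+ k∪)  ≤⟨ ℕ.+-mono-≤ (ℕ.+-monoʳ-≤ s k∩≤) t+k∪≤b ⟩
    (s ℕ.+ suc k) ℕ.+ b        ≡⟨ ≡.cong (ℕ._+ b) (ℕ.+-suc s k) ⟩
    suc (s ℕ.+ k) ℕ.+ b        ≤⟨ s≤s (ℕ.+-monoˡ-≤ b s+k≤b) ⟩
    suc b ℕ.+ b                <⟨ ℕ.+-monoʳ-< (suc b) (ℕ.n<1+n b) ⟩
    suc b ℕ.+ suc b            ∎))
  where
  open ℕ.≤-Reasoning
  open CommutativeSemigroupProperties ℕ.+-commutativeSemigroup using (interchange)

-- Linear algebra over a division ring: subspaces, spans and exchange.

module FiniteDimension
  {r ℓr m ℓm p : Level} {R : Ring r ℓr} (V : LeftModule R m ℓm)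
  (isDivisionRing : IsDivisionRing R)
  (em : ExcludedMiddle (r ⊔ ℓr ⊔ m ⊔ ℓm ⊔ p))
  where

  open Ring R using (Carrier; _≈_; 0#; 1#; _+_; _*_; -_)
  private module R where
    open Ring R public
    open RingProperties R public using (-‿involutive; -0#≈0#)
  open LeftModule V
  open LeftModuleProperties V using (inverseˡ-uniqueᴹ)
  open CommutativeSemigroupProperties (CommutativeMonoid.commutativeSemigroup +ᴹ-commutativeMonoid)
    using (interchange)
  open CommutativeMonoidSum +ᴹ-commutativeMonoid using (sum-cong-≋; sum-remove; sum-replicate-zero)
  open LinearAlgebra V
  open IsDivisionRing isDivisionRing
  module ≈ᴹ-Reasoning = SetoidReasoning ≈ᴹ-setoid

  private
    ℓ = r ⊔ ℓr ⊔ m ⊔ ℓm ⊔ p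

  -- One fixed level, that of excluded middle: membership is decidable, and intersections, sums,
  -- images and preimages are again of this type.
  Sub : Set _
  Sub = Subspace ℓ

  private
    variable
      x y : Carrierᴹ
      c d : Carrier
      xs ys : List Carrierᴹ
      U : Sub

  open Subspace using (resp; 0-closed; +-closed; *ₗ-closed)

  _≈0? : ∀ c → Dec (c ≈ 0#)
  c ≈0? = map′ lower lift (em {Lift ℓ (c ≈ 0#)})

  _∈?_ : ∀ x (W : Sub) → Dec (x ∈ member W)
  x ∈? W = em

  ∃∉-or-⊆ : (P Q : Sub) → (∃[ x ] (x ∈ member P × x ∉ member Q)) ⊎ (member P ⊆ member Q)
  ∃∉-or-⊆ P Q with em {∃[ x ] (x ∈ member P × x ∉ member Q)}
  ... | yes w = inj₁ w
  ... | no ¬w = inj₂ λ {x} x∈P → [x∈Q] x∈P (x ∈? Q)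
    where
    [x∈Q] : ∀ {x} → x ∈ member P → Dec (x ∈ member Q) → x ∈ member Q
    [x∈Q] x∈P (yes x∈Q) = x∈Q
    [x∈Q] x∈P (no x∉Q)  = contradiction (_ , x∈P , x∉Q) ¬w

  -‿*ₗ : ∀ c x → (- c) *ₗ x ≈ᴹ -ᴹ (c *ₗ x)
  -‿*ₗ c x = inverseˡ-uniqueᴹ _ _ (begin
    (- c) *ₗ x +ᴹ c *ₗ x ≈⟨ *ₗ-distribʳ x (- c) c ⟨
    (- c + c) *ₗ x       ≈⟨ *ₗ-congʳ (R.-‿inverseˡ c) ⟩
    0# *ₗ x              ≈⟨ *ₗ-zeroˡ x ⟩
    0ᴹ                   ∎)
    where open ≈ᴹ-Reasoning

  -1*ₗ : ∀ x → (- 1#) *ₗ x ≈ᴹ -ᴹ x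
  -1*ₗ x = ≈ᴹ-trans (-‿*ₗ 1# x) (-ᴹ‿cong (*ₗ-identityˡ x))

  x+y-y≈x : ∀ x y → (x +ᴹ y) +ᴹ -ᴹ y ≈ᴹ x
  x+y-y≈x x y = begin
    (x +ᴹ y) +ᴹ -ᴹ y ≈⟨ +ᴹ-assoc x y (-ᴹ y) ⟩
    x +ᴹ (y +ᴹ -ᴹ y) ≈⟨ +ᴹ-congˡ (-ᴹ‿inverseʳ y) ⟩
    x +ᴹ 0ᴹ          ≈⟨ +ᴹ-identityʳ x ⟩
    x                ∎
    where open ≈ᴹ-Reasoning

  -ᴹ-closed : (W : Sub) → x ∈ member W → -ᴹ x ∈ member W
  -ᴹ-closed W x∈W = resp W (-1*ₗ _) (*ₗ-closed W (- 1#) x∈W)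

  +-cancelʳ-∈ : (W : Sub) → (x +ᴹ y) ∈ member W → y ∈ member W → x ∈ member W
  +-cancelʳ-∈ W x+y∈W y∈W = resp W (x+y-y≈x _ _) (+-closed W x+y∈W (-ᴹ-closed W y∈W))

  +-cancelˡ-∈ : (W : Sub) → (x +ᴹ y) ∈ member W → x ∈ member W → y ∈ member W
  +-cancelˡ-∈ W x+y∈W = +-cancelʳ-∈ W (resp W (+ᴹ-comm _ _) x+y∈W)

  *ₗ-cancel-∈ : (W : Sub) → (c *ₗ x) ∈ member W → x ∉ member W → c ≈ 0#
  *ₗ-cancel-∈ {c} {x} W cx∈W x∉W with c ≈0?
  ... | yes c≈0 = c≈0
  ... | no c≉0 = contradiction (resp W c⁻¹cx≈x (*ₗ-closed W c⁻¹ cx∈W)) x∉W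
    where
    c⁻¹ = proj₁ (inverse c c≉0)
    c⁻¹cx≈x : c⁻¹ *ₗ (c *ₗ x) ≈ᴹ x
    c⁻¹cx≈x = begin
      c⁻¹ *ₗ (c *ₗ x) ≈⟨ *ₗ-assoc c⁻¹ c x ⟨
      (c⁻¹ * c) *ₗ x  ≈⟨ *ₗ-congʳ (proj₁ (proj₂ (inverse c c≉0))) ⟩
      1# *ₗ x         ≈⟨ *ₗ-identityˡ x ⟩
      x               ∎
      where open ≈ᴹ-Reasoning

  0ₛ : Sub
  0ₛ = record
    { member    = λ x → Lift ℓ (x ≈ᴹ 0ᴹ)
    ; resp      = λ x≈y (lift x≈0) → lift (≈ᴹ-trans (≈ᴹ-sym x≈y) x≈0)
    ; 0-closed  = lift ≈ᴹ-refl
    ; +-closed  = λ (lift x≈0) (lift y≈0) → lift (≈ᴹ-trans (+ᴹ-cong x≈0 y≈0) (+ᴹ-identityˡ 0ᴹ))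
    ; *ₗ-closed = λ c (lift x≈0) → lift (≈ᴹ-trans (*ₗ-congˡ x≈0) (*ₗ-zeroʳ c))
    }

  infixr 7 _∩ₛ_
  infixl 6 _+ₛ_ _+⟨_⟩

  _∩ₛ_ : Sub → Sub → Sub
  P ∩ₛ Q = record
    { member    = λ x → x ∈ member P × x ∈ member Q
    ; resp      = λ x≈y (x∈P , x∈Q) → resp P x≈y x∈P , resp Q x≈y x∈Q
    ; 0-closed  = 0-closed P , 0-closed Q
    ; +-closed  = λ (x∈P , x∈Q) (y∈P , y∈Q) → +-closed P x∈P y∈P , +-closed Q x∈Q y∈Q
    ; *ₗ-closed = λ c (x∈P , x∈Q) → *ₗ-closed P c x∈P , *ₗ-closed Q c x∈Q
    }

  ⋂ : {I : Set} → (I → Sub) → Sub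
  ⋂ W = record
    { member    = λ x → ∀ i → x ∈ member (W i)
    ; resp      = λ x≈y x∈W i → resp (W i) x≈y (x∈W i)
    ; 0-closed  = λ i → 0-closed (W i)
    ; +-closed  = λ x∈W y∈W i → +-closed (W i) (x∈W i) (y∈W i)
    ; *ₗ-closed = λ c x∈W i → *ₗ-closed (W i) c (x∈W i)
    }

  _+ₛ_ : Sub → Sub → Sub
  P +ₛ Q = record
    { member    = λ x → ∃[ u ] ∃[ v ] (u ∈ member P × v ∈ member Q × x ≈ᴹ u +ᴹ v)
    ; resp      = λ x≈y (u , v , u∈P , v∈Q , x≈u+v) → u , v , u∈P , v∈Q , ≈ᴹ-trans (≈ᴹ-sym x≈y) x≈u+v
    ; 0-closed  = 0ᴹ , 0ᴹ , 0-closed P , 0-closed Q , ≈ᴹ-sym (+ᴹ-identityˡ 0ᴹ)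
    ; +-closed  = λ (u , v , u∈P , v∈Q , x≈u+v) (u′ , v′ , u′∈P , v′∈Q , y≈u′+v′) →
        u +ᴹ u′ , v +ᴹ v′ , +-closed P u∈P u′∈P , +-closed Q v∈Q v′∈Q ,
        ≈ᴹ-trans (+ᴹ-cong x≈u+v y≈u′+v′) (interchange u v u′ v′)
    ; *ₗ-closed = λ c (u , v , u∈P , v∈Q , x≈u+v) →
        c *ₗ u , c *ₗ v , *ₗ-closed P c u∈P , *ₗ-closed Q c v∈Q ,
        ≈ᴹ-trans (*ₗ-congˡ x≈u+v) (*ₗ-distribˡ c u v)
    }

  -- `W` plus the line through `x`. The only witness is the scalar that carries a vector into `W`,
  -- so its sign is opposite to that of the usual coefficient of `x`.
  _+⟨_⟩ : Sub → Carrierᴹ → Sub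
  W +⟨ x ⟩ = record
    { member    = λ y → ∃[ c ] (y +ᴹ c *ₗ x) ∈ member W
    ; resp      = λ y≈z (c , y+cx∈W) → c , resp W (+ᴹ-congʳ y≈z) y+cx∈W
    ; 0-closed  = 0# , resp W (≈ᴹ-sym (≈ᴹ-trans (+ᴹ-identityˡ _) (*ₗ-zeroˡ x))) (0-closed W)
    ; +-closed  = λ {y} {z} (c , y+cx∈W) (d , z+dx∈W) → c + d ,
        resp W (≈ᴹ-trans (interchange y (c *ₗ x) z (d *ₗ x)) (+ᴹ-congˡ (≈ᴹ-sym (*ₗ-distribʳ x c d))))
          (+-closed W y+cx∈W z+dx∈W)
    ; *ₗ-closed = λ d {y} (c , y+cx∈W) → d * c ,
        resp W (≈ᴹ-trans (*ₗ-distribˡ d y (c *ₗ x)) (+ᴹ-congˡ (≈ᴹ-sym (*ₗ-assoc d c x))))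
          (*ₗ-closed W d y+cx∈W)
    }

  ⊆+⟨⟩ : (W : Sub) → member W ⊆ member (W +⟨ x ⟩)
  ⊆+⟨⟩ {x} W y∈W = 0# , resp W (≈ᴹ-sym (≈ᴹ-trans (+ᴹ-congˡ (*ₗ-zeroˡ x)) (+ᴹ-identityʳ _))) y∈W

  ∈+⟨⟩ : (W : Sub) → x ∈ member (W +⟨ x ⟩)
  ∈+⟨⟩ {x} W = - 1# , resp W (≈ᴹ-sym (≈ᴹ-trans (+ᴹ-congˡ (-1*ₗ x)) (-ᴹ‿inverseʳ x))) (0-closed W)

  +⟨⟩-least : (W : Sub) → member U ⊆ member W → x ∈ member W → member (U +⟨ x ⟩) ⊆ member W
  +⟨⟩-least W U⊆W x∈W (c , y+cx∈U) = +-cancelʳ-∈ W (U⊆W y+cx∈U) (*ₗ-closed W c x∈W)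

  +⟨⟩-mono : (U W : Sub) → member U ⊆ member W → member (U +⟨ x ⟩) ⊆ member (W +⟨ x ⟩)
  +⟨⟩-mono U W U⊆W (c , y+cx∈U) = c , U⊆W y+cx∈U

  -- If `y + c x` is in `W` and `y` is not, then `c` is nonzero and `x` can be solved for. The
  -- argument runs contrapositively: `x` outside `W +⟨ y ⟩` forces `c` to vanish, hence `y` into
  -- `W`.
  +⟨⟩-exchange : (W : Sub) → y ∈ member (W +⟨ x ⟩) → y ∉ member W →
                 member (W +⟨ x ⟩) ⊆ member (W +⟨ y ⟩)
  +⟨⟩-exchange {y} {x} W (c , y+cx∈W) y∉W = +⟨⟩-least {U = W} (W +⟨ y ⟩) (⊆+⟨⟩ W) x∈W+y
    where
    x∈W+y : x ∈ member (W +⟨ y ⟩)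
    x∈W+y with x ∈? (W +⟨ y ⟩)
    ... | yes x∈ = x∈
    ... | no x∉ = contradiction (+-cancelʳ-∈ W y+cx∈W cx∈W) y∉W
      where
      c≈0 = *ₗ-cancel-∈ (W +⟨ y ⟩) (+-cancelˡ-∈ (W +⟨ y ⟩) (⊆+⟨⟩ W y+cx∈W) (∈+⟨⟩ W)) x∉
      cx∈W = resp W (≈ᴹ-sym (≈ᴹ-trans (*ₗ-congʳ c≈0) (*ₗ-zeroˡ x))) (0-closed W)

  span : List Carrierᴹ → Sub
  span []       = 0ₛ
  span (x ∷ xs) = span xs +⟨ x ⟩

  span-least : (W : Sub) → All (member W) xs → member (span xs) ⊆ member W
  span-least W []                  (lift y≈0) = resp W (≈ᴹ-sym y≈0) (0-closed W)
  span-least W (_∷_ {xs = xs} x∈W xs∈W) = +⟨⟩-least {U = span xs} W (span-least W xs∈W) x∈W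

  -- Over a division ring this triangular condition amounts to linear independence, in a form suited
  -- to adding and exchanging vectors one at a time.
  Independent : List Carrierᴹ → Set _
  Independent []       = ⊤ {ℓ}
  Independent (x ∷ xs) = x ∉ member (span xs) × Independent xs

  -- u is a pivot: adding a multiple of u moves any vector of W +⟨ y ⟩ into W.
  eliminate : (W : Sub) (xs : List Carrierᴹ) → Independent xs → All (member (W +⟨ y ⟩)) xs →
    All (member W) xs ⊎
    (∃[ u ] (u ∈ member (span xs) × u ∉ member W)) ×
    (∃[ zs ] (Independent zs × All (member W) zs ×
              member (span zs) ⊆ member (span xs) × suc (length zs) ≡ length xs))
  eliminate W [] ind [] = inj₁ []
  eliminate {y} W (x ∷ xs) (x∉ , ind) (x∈ ∷ xs∈) with eliminate W xs ind xs∈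
  ... | inj₁ xs∈W with x ∈? W
  ...   | yes x∈W = inj₁ (x∈W ∷ xs∈W)
  ...   | no x∉W = inj₂ ((x , ∈+⟨⟩ (span xs) , x∉W) , xs , ind , xs∈W , ⊆+⟨⟩ (span xs) , ≡.refl)
  eliminate {y} W (x ∷ xs) (x∉ , ind) (x∈ ∷ xs∈)
      | inj₂ ((u , u∈ , u∉W) , zs , ind′ , zs∈W , zs⊆xs , eq) =
    inj₂ ((u , ⊆+⟨⟩ (span xs) u∈ , u∉W) ,
      (x +ᴹ e *ₗ u) ∷ zs ,
      ((λ z∈ → x∉ (+-cancelʳ-∈ (span xs) (zs⊆xs z∈) (*ₗ-closed (span xs) e u∈))) , ind′) ,
      x+eu∈W ∷ zs∈W ,
      +⟨⟩-least {U = span zs} (span (x ∷ xs)) (⊆+⟨⟩ (span xs) ∘ zs⊆xs)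
        (+-closed (span (x ∷ xs)) (∈+⟨⟩ (span xs)) (⊆+⟨⟩ (span xs) (*ₗ-closed (span xs) e u∈))) ,
      ≡.cong suc eq)
    where
    u∈W+y = span-least (W +⟨ y ⟩) xs∈ u∈
    x∈W+u = +⟨⟩-exchange W u∈W+y u∉W x∈
    e = proj₁ x∈W+u
    x+eu∈W = proj₂ x∈W+u

  -- Induction on `ys`: passing from `span (y ∷ ys)` to `span ys` costs an independent list at most
  -- one vector, by elimination with a pivot.
  steinitz : ∀ xs ys → Independent xs → All (member (span ys)) xs → length xs ≤ length ys
  steinitz []       []       ind xs∈ = z≤n
  steinitz (x ∷ xs) []       (x∉ , ind) (lift x≈0 ∷ xs∈) =
    contradiction (resp (span xs) (≈ᴹ-sym x≈0) (0-closed (span xs))) x∉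
  steinitz xs       (y ∷ ys) ind xs∈ with eliminate (span ys) xs ind xs∈
  ... | inj₁ xs∈ys = ℕ.m≤n⇒m≤1+n (steinitz xs ys ind xs∈ys)
  ... | inj₂ (_ , zs , ind′ , zs∈ , _ , eq) =
    ≡.subst (_≤ suc (length ys)) eq (s≤s (steinitz zs ys ind′ zs∈))

  -- Linear maps: images, preimages and independence.

  open LeftModuleMorphisms rawLeftModule rawLeftModule
    using (IsLeftModuleHomomorphism; IsLeftModuleMonomorphism)

  module _ {f : Carrierᴹ → Carrierᴹ} (f-homo : IsLeftModuleHomomorphism f) where

    open IsLeftModuleHomomorphism f-homo using (⟦⟧-cong; +ᴹ-homo; 0ᴹ-homo; *ₗ-homo)

    preimage : Sub → Sub
    preimage W = record
      { member    = λ x → f x ∈ member W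
      ; resp      = λ x≈y → resp W (⟦⟧-cong x≈y)
      ; 0-closed  = resp W (≈ᴹ-sym 0ᴹ-homo) (0-closed W)
      ; +-closed  = λ fx∈W fy∈W → resp W (≈ᴹ-sym (+ᴹ-homo _ _)) (+-closed W fx∈W fy∈W)
      ; *ₗ-closed = λ c fx∈W → resp W (≈ᴹ-sym (*ₗ-homo c _)) (*ₗ-closed W c fx∈W)
      }

    image : Sub → Sub
    image W = record
      { member    = λ y → ∃[ x ] (x ∈ member W × y ≈ᴹ f x)
      ; resp      = λ y≈z (x , x∈W , y≈fx) → x , x∈W , ≈ᴹ-trans (≈ᴹ-sym y≈z) y≈fx
      ; 0-closed  = 0ᴹ , 0-closed W , ≈ᴹ-sym 0ᴹ-homo
      ; +-closed  = λ (x , x∈W , y≈fx) (x′ , x′∈W , y′≈fx′) → x +ᴹ x′ , +-closed W x∈W x′∈W ,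
          ≈ᴹ-trans (+ᴹ-cong y≈fx y′≈fx′) (≈ᴹ-sym (+ᴹ-homo x x′))
      ; *ₗ-closed = λ c (x , x∈W , y≈fx) → c *ₗ x , *ₗ-closed W c x∈W ,
          ≈ᴹ-trans (*ₗ-congˡ y≈fx) (≈ᴹ-sym (*ₗ-homo c x))
      }

    ∈-span-map⁺ : ∀ xs → y ∈ member (span xs) → f y ∈ member (span (map f xs))
    ∈-span-map⁺ []       (lift y≈0) = lift (≈ᴹ-trans (⟦⟧-cong y≈0) 0ᴹ-homo)
    ∈-span-map⁺ (x ∷ xs) (c , y+cx∈) = c ,
      resp (span (map f xs)) (≈ᴹ-trans (+ᴹ-homo _ _) (+ᴹ-congˡ (*ₗ-homo c x))) (∈-span-map⁺ xs y+cx∈)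

  module _ {f : Carrierᴹ → Carrierᴹ} (f-mono : IsLeftModuleMonomorphism f) where

    open IsLeftModuleMonomorphism f-mono using (injective; +ᴹ-homo; 0ᴹ-homo; *ₗ-homo)

    ∈-span-map⁻ : ∀ xs → f y ∈ member (span (map f xs)) → y ∈ member (span xs)
    ∈-span-map⁻ []       (lift fy≈0) = lift (injective (≈ᴹ-trans fy≈0 (≈ᴹ-sym 0ᴹ-homo)))
    ∈-span-map⁻ (x ∷ xs) (c , fy+cfx∈) = c , ∈-span-map⁻ xs
      (resp (span (map f xs)) (≈ᴹ-sym (≈ᴹ-trans (+ᴹ-homo _ _) (+ᴹ-congˡ (*ₗ-homo c x)))) fy+cfx∈)

    independent-map : ∀ xs → Independent xs → Independent (map f xs)
    independent-map []       ind        = tt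
    independent-map (x ∷ xs) (x∉ , ind) = x∉ ∘ ∈-span-map⁻ xs , independent-map xs ind


  -- Indexed families, lists of vectors, and coordinates.

  select : ∀ {n} → Subset n → Vector Carrierᴹ n → List Carrierᴹ
  select Vec.[]              v = []
  select (outside Vec.∷ J) v = select J (v ∘ suc)
  select (inside Vec.∷ J)  v = v zero ∷ select J (v ∘ suc)

  length-select : ∀ {n} (J : Subset n) v → length (select J v) ≡ ∣ J ∣
  length-select Vec.[]              v = ≡.refl
  length-select (outside Vec.∷ J) v = length-select J (v ∘ suc)
  length-select (inside Vec.∷ J)  v = ≡.cong suc (length-select J (v ∘ suc))

  select⁺ : ∀ {n q} {P : Pred Carrierᴹ q} (J : Subset n) {v} →
            (∀ {i} → i Subset.∈ J → P (v i)) → All P (select J v)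
  select⁺ Vec.[]              Pv = []
  select⁺ (outside Vec.∷ J) Pv = select⁺ J (Pv ∘ Vec.there)
  select⁺ (inside Vec.∷ J)  Pv = Pv Vec.here ∷ select⁺ J (Pv ∘ Vec.there)

  ∈-span : ∀ xs → All (_∈ member (span xs)) xs
  ∈-span []       = []
  ∈-span (x ∷ xs) = ∈+⟨⟩ (span xs) ∷ All.map (⊆+⟨⟩ (span xs)) (∈-span xs)

  independent-select : ∀ {n} (J : Subset n) v → Independent (tabulate v) → Independent (select J v)
  independent-select Vec.[]              v ind        = tt
  independent-select (outside Vec.∷ J) v (_  , ind) = independent-select J (v ∘ suc) ind
  independent-select (inside Vec.∷ J)  v (v₀∉ , ind) =
    v₀∉ ∘ span-least (span (tabulate (v ∘ suc)))
      (select⁺ J λ {i} _ → All.tabulate⁻ (∈-span (tabulate (v ∘ suc))) i) ,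
    independent-select J (v ∘ suc) ind

  Span⇒span : ∀ {n} (v : Vector Carrierᴹ n) → Span v ⊆ member (span (tabulate v))
  Span⇒span {zero}  v (c , y≈) = lift y≈
  -- The witness is the scalar that cancels the term at `zero`, hence the sign.
  Span⇒span {suc n} v {y} (c , y≈) = - c zero ,
    resp (span (tabulate (v ∘ suc))) (≈ᴹ-sym y-c₀v₀≈) (Span⇒span (v ∘ suc) (c ∘ suc , ≈ᴹ-refl))
    where
    open ≈ᴹ-Reasoning
    rest = linearCombination (c ∘ suc) (v ∘ suc)
    y-c₀v₀≈ : y +ᴹ (- c zero) *ₗ v zero ≈ᴹ rest
    y-c₀v₀≈ = begin
      y +ᴹ (- c zero) *ₗ v zero
        ≈⟨ +ᴹ-cong (≈ᴹ-trans y≈ (+ᴹ-comm _ rest)) (-‿*ₗ (c zero) (v zero)) ⟩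
      (rest +ᴹ c zero *ₗ v zero) +ᴹ -ᴹ (c zero *ₗ v zero) ≈⟨ x+y-y≈x rest _ ⟩
      rest                                               ∎

  span⇒Span : ∀ {n} (v : Vector Carrierᴹ n) → member (span (tabulate v)) ⊆ Span v
  span⇒Span {zero}  v (lift y≈) = (λ ()) , y≈
  span⇒Span {suc n} v {y} (c , y+cv₀∈) with span⇒Span (v ∘ suc) y+cv₀∈
  ... | d , y+cv₀≈ = - c Vector.∷ d , (begin
    y                                                          ≈⟨ x+y-y≈x y (c *ₗ v zero) ⟨
    (y +ᴹ c *ₗ v zero) +ᴹ -ᴹ (c *ₗ v zero)                     ≈⟨ +ᴹ-cong y+cv₀≈ (≈ᴹ-sym (-‿*ₗ c (v zero))) ⟩
    linearCombination d (v ∘ suc) +ᴹ (- c) *ₗ v zero           ≈⟨ +ᴹ-comm _ _ ⟩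
    linearCombination (- c Vector.∷ d) v                       ∎)
    where open ≈ᴹ-Reasoning

  linearCombination-0 : ∀ {n} (c : Vector Carrier n) v → (∀ i → c i ≈ 0#) → linearCombination c v ≈ᴹ 0ᴹ
  linearCombination-0 {n} c v c≈0 =
    ≈ᴹ-trans (sum-cong-≋ λ i → ≈ᴹ-trans (*ₗ-congʳ (c≈0 i)) (*ₗ-zeroˡ (v i))) (sum-replicate-zero n)

  linearCombination-closed : ∀ {n} (W : Sub) (c : Vector Carrier n) v → (∀ i → v i ∈ member W) →
                             linearCombination c v ∈ member W
  linearCombination-closed {zero}  W c v v∈W = 0-closed W
  linearCombination-closed {suc n} W c v v∈W = +-closed W (*ₗ-closed W (c zero) (v∈W zero))
    (linearCombination-closed W (c ∘ suc) (v ∘ suc) (v∈W ∘ suc))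

  linearCombination-removeAt : ∀ {n} (c : Vector Carrier (suc n)) v i → linearCombination c v ≈ᴹ
    c i *ₗ v i +ᴹ linearCombination (removeAt c i) (removeAt v i)
  linearCombination-removeAt c v i = sum-remove {i = i} (λ j → c j *ₗ v j)

  -- Modulo `W` the combination reduces to the single term `c i *ₗ v i`. Below, `W` is the span of
  -- the other vectors in one implication and a hyperplane containing them in the other.
  coordinate≈0 : ∀ {n} (W : Sub) (c : Vector Carrier n) v i → (∀ j → j ≢ i → v j ∈ member W) → v i ∉ member W →
                 linearCombination c v ∈ member W → c i ≈ 0#
  coordinate≈0 {suc n} W c v i v∈W vᵢ∉W lc∈W = *ₗ-cancel-∈ W
    (+-cancelʳ-∈ W (resp W (linearCombination-removeAt c v i) lc∈W)
      (linearCombination-closed W (removeAt c i) (removeAt v i) (λ j → v∈W _ (punchInᵢ≢i i j)))) vᵢ∉W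

  ∈-Span-omit : ∀ {n} (c : Vector Carrier n) v i → c i ≈ 0# → linearCombination c v ∈ Span (omit v i)
  ∈-Span-omit {suc n} c v i cᵢ≈0 = removeAt c i , (begin
    linearCombination c v                                              ≈⟨ linearCombination-removeAt c v i ⟩
    c i *ₗ v i +ᴹ linearCombination (removeAt c i) (removeAt v i)
      ≈⟨ +ᴹ-congʳ (≈ᴹ-trans (*ₗ-congʳ cᵢ≈0) (*ₗ-zeroˡ (v i))) ⟩
    0ᴹ +ᴹ linearCombination (removeAt c i) (removeAt v i)              ≈⟨ +ᴹ-identityˡ _ ⟩
    linearCombination (removeAt c i) (removeAt v i)                    ∎)
    where open ≈ᴹ-Reasoning

  -- Inserting the coefficient `- 1#` at `i` turns an expression of `v i` by the others into a
  -- relation, so independence would give `- 1# ≈ 0#`.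
  independent⇒∉Span-omit : ∀ {n} (v : Vector Carrierᴹ n) → LinearlyIndependent v → ∀ i → v i ∉ Span (omit v i)
  independent⇒∉Span-omit {suc n} v ind i (d , vᵢ≈) =
    1≉0 (R.trans (R.sym (R.-‿involutive 1#)) (R.trans (R.-‿cong -1≈0) R.-0#≈0#))
    where
    open ≈ᴹ-Reasoning
    e = insertAt d i (- 1#)
    rest = linearCombination d (removeAt v i)
    lc≈0 : linearCombination e v ≈ᴹ 0ᴹ
    lc≈0 = begin
      linearCombination e v                                          ≈⟨ linearCombination-removeAt e v i ⟩
      e i *ₗ v i +ᴹ linearCombination (removeAt e i) (removeAt v i)
        ≈⟨ +ᴹ-cong (*ₗ-congʳ (R.reflexive (insertAt-lookup d i (- 1#))))
                   (sum-cong-≋ λ j → *ₗ-congʳ (R.reflexive (insertAt-punchIn d i (- 1#) j))) ⟩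
      (- 1#) *ₗ v i +ᴹ rest
        ≈⟨ +ᴹ-cong (≈ᴹ-trans (-1*ₗ (v i)) (-ᴹ‿cong vᵢ≈)) ≈ᴹ-refl ⟩
      -ᴹ rest +ᴹ rest                                                ≈⟨ -ᴹ‿inverseˡ rest ⟩
      0ᴹ                                                             ∎
    -1≈0 : - 1# ≈ 0#
    -1≈0 = R.trans (R.sym (R.reflexive (insertAt-lookup d i (- 1#)))) (ind e lc≈0 i)

  ∈-span-omit : ∀ {n} (v : Vector Carrierᴹ n) i j → j ≢ i → v j ∈ member (span (tabulate (omit v i)))
  ∈-span-omit {suc n} v i j j≢i = ≡.subst (λ h → v h ∈ member (span (tabulate (omit v i))))
    (punchIn-punchOut (j≢i ∘ ≡.sym)) (All.tabulate⁻ (∈-span (tabulate (omit v i))) (punchOut (j≢i ∘ ≡.sym)))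

  independent-tabulate : ∀ {n} (v : Vector Carrierᴹ n) → LinearlyIndependent v → Independent (tabulate v)
  independent-tabulate {zero}  v ind = tt
  independent-tabulate {suc n} v ind =
    independent⇒∉Span-omit v ind zero ∘ span⇒Span (v ∘ suc) ,
    independent-tabulate (v ∘ suc) λ c lc≈0 i → ind (0# Vector.∷ c)
      (≈ᴹ-trans (+ᴹ-cong (*ₗ-zeroˡ (v zero)) lc≈0) (+ᴹ-identityˡ 0ᴹ)) (suc i)

  -- dim W is the dimension of W ∩ B.
  module Dimension (B : Sub) (gens : List Carrierᴹ) (B⊆gens : member B ⊆ member (span gens)) where

    -- Bases and dimensions of subspaces within `B`.

    independent-length : ∀ xs → Independent xs → All (member B) xs → length xs ≤ length gens
    independent-length xs ind xs∈B = steinitz xs gens ind (All.map B⊆gens xs∈B)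

    -- The counter `k` makes the search finite: `length xs + k` stays at least the number of
    -- generators, so at `zero` one further independent vector would contradict Steinitz exchange.
    extend : (W : Sub) (xs : List Carrierᴹ) (k : ℕ) → length gens ≤ length xs ℕ.+ k →
      Independent xs → All (member (W ∩ₛ B)) xs →
      ∃[ ys ] (Independent (ys ++ xs) × All (member (W ∩ₛ B)) ys × member (W ∩ₛ B) ⊆ member (span (ys ++ xs)))
    extend W xs k bound ind xs∈ with ∃∉-or-⊆ (W ∩ₛ B) (span xs)
    ... | inj₂ W⊆ = [] , ind , [] , W⊆
    extend W xs zero bound ind xs∈ | inj₁ (y , y∈ , y∉) =
      contradiction (independent-length (y ∷ xs) (y∉ , ind) (All.map proj₂ (y∈ ∷ xs∈)))
        (ℕ.<⇒≱ (s≤s (≡.subst (length gens ≤_) (ℕ.+-identityʳ (length xs)) bound)))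
    extend W xs (suc k) bound ind xs∈ | inj₁ (y , y∈ , y∉)
      with extend W (y ∷ xs) k (≡.subst (length gens ≤_) (ℕ.+-suc (length xs) k) bound) (y∉ , ind) (y∈ ∷ xs∈)
    ... | ys , ind′ , ys∈ , W⊆ = ys ++ y ∷ [] ,
      ≡.subst Independent assoc ind′ , All.++⁺ ys∈ (y∈ ∷ []) ,
      λ x∈ → ≡.subst (λ zs → _ ∈ member (span zs)) assoc (W⊆ x∈)
      where
      assoc : ys ++ y ∷ xs ≡ (ys ++ y ∷ []) ++ xs
      assoc = ≡.sym (++-assoc ys (y ∷ []) xs)

    extendToBasis : (W : Sub) (xs : List Carrierᴹ) → Independent xs → All (member (W ∩ₛ B)) xs →
      ∃[ ys ] (Independent (ys ++ xs) × All (member (W ∩ₛ B)) ys × member (W ∩ₛ B) ⊆ member (span (ys ++ xs)))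
    extendToBasis W xs = extend W xs (length gens) (ℕ.m≤n+m (length gens) (length xs))

    abstract
      -- An extension of the empty list. It is kept opaque, since only the properties of the chosen
      -- basis are used, never its construction.
      hasBasis : (W : Sub) →
        ∃[ xs ] (Independent xs × All (member (W ∩ₛ B)) xs × member (W ∩ₛ B) ⊆ member (span xs))
      hasBasis W with extendToBasis W [] tt []
      ... | ys , rest = ys , ≡.subst
        (λ zs → Independent zs × All (member (W ∩ₛ B)) ys × member (W ∩ₛ B) ⊆ member (span zs))
        (++-identityʳ ys) rest

    basis : Sub → List Carrierᴹ
    basis W = proj₁ (hasBasis W)

    basis-independent : (W : Sub) → Independent (basis W)
    basis-independent W = proj₁ (proj₂ (hasBasis W))

    basis-∈ : (W : Sub) → All (member (W ∩ₛ B)) (basis W)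
    basis-∈ W = proj₁ (proj₂ (proj₂ (hasBasis W)))

    basis-spans : (W : Sub) → member (W ∩ₛ B) ⊆ member (span (basis W))
    basis-spans W = proj₂ (proj₂ (proj₂ (hasBasis W)))

    dim : Sub → ℕ
    dim W = length (basis W)

    independent⇒≤dim : (W : Sub) → Independent xs → All (member (W ∩ₛ B)) xs → length xs ≤ dim W
    independent⇒≤dim {xs} W ind xs∈ = steinitz xs (basis W) ind (All.map (basis-spans W) xs∈)

    span⇒dim≤ : (W : Sub) → member (W ∩ₛ B) ⊆ member (span xs) → dim W ≤ length xs
    span⇒dim≤ {xs} W W⊆ = steinitz (basis W) xs (basis-independent W) (All.map W⊆ (basis-∈ W))

    dim-mono : (P Q : Sub) → member (P ∩ₛ B) ⊆ member Q → dim P ≤ dim Q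
    dim-mono P Q P⊆Q =
      independent⇒≤dim Q (basis-independent P) (All.map (λ y∈ → P⊆Q y∈ , proj₂ y∈) (basis-∈ P))

    dim-zero : (W : Sub) → (∀ {x} → x ∈ member (W ∩ₛ B) → x ≈ᴹ 0ᴹ) → dim W ≡ 0
    dim-zero W W≈0 = ℕ.n≤0⇒n≡0 (span⇒dim≤ {[]} W (λ x∈ → lift (W≈0 x∈)))

    -- A vector of `Q` outside the span of the basis chosen for `P` would prolong that basis to
    -- `dim P + 1` independent vectors of `Q`.
    dim≤⇒⊆ : (P Q : Sub) → member P ⊆ member Q → member Q ⊆ member B → dim Q ≤ dim P → member Q ⊆ member P
    dim≤⇒⊆ P Q P⊆Q Q⊆B dimQ≤dimP {x} x∈Q with x ∈? span (basis P)
    ... | yes x∈ = span-least P (All.map proj₁ (basis-∈ P)) x∈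
    ... | no x∉ = contradiction
      (independent⇒≤dim Q (x∉ , basis-independent P)
        ((x∈Q , Q⊆B x∈Q) ∷ All.map (λ (y∈P , y∈B) → P⊆Q y∈P , y∈B) (basis-∈ P)))
      (ℕ.<⇒≱ (s≤s dimQ≤dimP))

    dim-+⟨⟩ : (P Q : Sub) → member (P ∩ₛ B) ⊆ member (Q +⟨ x ⟩) → member Q ⊆ member B → dim P ≤ suc (dim Q)
    dim-+⟨⟩ {x} P Q P⊆ Q⊆B = span⇒dim≤ {x ∷ basis Q} P
      (λ y∈ → +⟨⟩-mono Q (span (basis Q)) (λ z∈ → basis-spans Q (z∈ , Q⊆B z∈)) (P⊆ y∈))

    dim-mono-map : {f : Carrierᴹ → Carrierᴹ} → IsLeftModuleMonomorphism f → (P Q : Sub) →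
      (∀ {x} → x ∈ member (P ∩ₛ B) → f x ∈ member (Q ∩ₛ B)) → dim P ≤ dim Q
    dim-mono-map {f} f-mono P Q f∈ = ≡.subst (_≤ dim Q) (length-map f (basis P))
      (independent⇒≤dim Q (independent-map f-mono (basis P) (basis-independent P))
        (All.map⁺ (All.map f∈ (basis-∈ P))))

    -- Extend a basis of `P ∩ₛ Q` to one of `P` by `ps`; then `ps` together with a basis of `Q` is
    -- still independent. Inside `B`, `S` is any subspace containing `P` and `Q`, and `T` any
    -- containing their intersection, so neither bound has to be exact.
    dim-submodular : (P Q S T : Sub) → member (P ∩ₛ B) ⊆ member S → member (Q ∩ₛ B) ⊆ member S →
      (∀ {x} → x ∈ member B → x ∈ member P → x ∈ member Q → x ∈ member T) →
      dim P ℕ.+ dim Q ≤ dim S ℕ.+ dim T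
    dim-submodular P Q S T P⊆S Q⊆S P∩Q⊆T
      with extendToBasis P (basis (P ∩ₛ Q)) (basis-independent (P ∩ₛ Q))
             (All.map (λ ((x∈P , _) , x∈B) → x∈P , x∈B) (basis-∈ (P ∩ₛ Q)))
    ... | ps , ind-ps , ps∈ , P⊆ = begin
      dim P ℕ.+ dim Q                        ≤⟨ ℕ.+-monoˡ-≤ _ (span⇒dim≤ {ps ++ rs} P P⊆) ⟩
      length (ps ++ rs) ℕ.+ length qs        ≡⟨ ≡.cong (ℕ._+ length qs) (length-++ ps) ⟩
      length ps ℕ.+ length rs ℕ.+ length qs  ≡⟨ xy∙z≈xz∙y (length ps) (length rs) (length qs) ⟩
      length ps ℕ.+ length qs ℕ.+ length rs  ≡⟨ ≡.cong (ℕ._+ length rs) (length-++ ps) ⟨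
      length (ps ++ qs) ℕ.+ length rs        ≤⟨ ℕ.+-mono-≤ |ps++qs|≤dimS |rs|≤dimT ⟩
      dim S ℕ.+ dim T                        ∎
      where
      open ℕ.≤-Reasoning
      open CommutativeSemigroupProperties ℕ.+-commutativeSemigroup using (xy∙z≈xz∙y)

      rs = basis (P ∩ₛ Q)
      qs = basis Q

      -- Once the contribution of `ps` is removed, the remaining vector is in both `P` and `Q`, and
      -- `rs` spans it.
      replace : ∀ ps → All (member (P ∩ₛ B)) ps → x ∈ member P → x ∈ member (span (ps ++ qs)) →
                x ∈ member (span (ps ++ rs))
      replace [] [] x∈P x∈ = basis-spans (P ∩ₛ Q)
        ((x∈P , span-least Q (All.map proj₁ (basis-∈ Q)) x∈) , span-least B (All.map proj₂ (basis-∈ Q)) x∈)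
      replace (y ∷ ps) (y∈ ∷ ps∈) x∈P (e , x+ey∈) =
        e , replace ps ps∈ (+-closed P x∈P (*ₗ-closed P e (proj₁ y∈))) x+ey∈

      independent : ∀ ps → All (member (P ∩ₛ B)) ps → Independent (ps ++ rs) → Independent (ps ++ qs)
      independent []       []         _          = basis-independent Q
      independent (y ∷ ps) (y∈ ∷ ps∈) (y∉ , ind) =
        y∉ ∘ replace ps ps∈ (proj₁ y∈) , independent ps ps∈ ind

      |ps++qs|≤dimS : length (ps ++ qs) ≤ dim S
      |ps++qs|≤dimS = independent⇒≤dim S (independent ps ps∈ ind-ps)
        (All.++⁺ (All.map (λ x∈ → P⊆S x∈ , proj₂ x∈) ps∈)
                 (All.map (λ x∈ → Q⊆S x∈ , proj₂ x∈) (basis-∈ Q)))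

      |rs|≤dimT : length rs ≤ dim T
      |rs|≤dimT = independent⇒≤dim T (basis-independent (P ∩ₛ Q))
        (All.map (λ ((x∈P , x∈Q) , x∈B) → P∩Q⊆T x∈B x∈P x∈Q , x∈B) (basis-∈ (P ∩ₛ Q)))

    dim-image≤ : {f : Carrierᴹ → Carrierᴹ} (f-homo : IsLeftModuleHomomorphism f) (W : Sub) →
      member W ⊆ member B → dim (image f-homo W) ≤ dim W
    dim-image≤ {f} f-homo W W⊆B = ≡.subst (dim (image f-homo W) ≤_) (length-map f (basis W))
      (span⇒dim≤ {map f (basis W)} (image f-homo W) λ ((x , x∈W , y≈fx) , _) →
        resp (span (map f (basis W))) (≈ᴹ-sym y≈fx)
        (∈-span-map⁺ f-homo (basis W) (basis-spans W (x∈W , W⊆B x∈W))))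

    -- Submodularity for `W` and `fW`: injectivity gives `fW` at least the dimension of `W`, and the
    -- intersection of `W` and `fW` is the image of `W∩f⁻¹W`.
    2dim≤dim+∩ : {f : Carrierᴹ → Carrierᴹ} (f-mono : IsLeftModuleMonomorphism f) (W : Sub) →
      (let f-homo = IsLeftModuleMonomorphism.isLeftModuleHomomorphism f-mono) →
      member W ⊆ member B → (∀ {x} → x ∈ member W → f x ∈ member B) →
      dim W ℕ.+ dim W ≤ dim (W +ₛ image f-homo W) ℕ.+ dim (W ∩ₛ preimage f-homo W)
    2dim≤dim+∩ {f} f-mono W W⊆B fW⊆B = begin
      dim W ℕ.+ dim W
        ≤⟨ ℕ.+-monoʳ-≤ (dim W) (dim-mono-map f-mono W fW (λ (x∈ , _) → (_ , x∈ , ≈ᴹ-refl) , fW⊆B x∈)) ⟩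
      dim W ℕ.+ dim fW
        ≤⟨ dim-submodular W fW (W +ₛ fW) (image f-homo W∩f⁻¹W)
             (λ (x∈W , _) → _ , 0ᴹ , x∈W , 0-closed fW , ≈ᴹ-sym (+ᴹ-identityʳ _))
             (λ (x∈fW , _) → 0ᴹ , _ , 0-closed W , x∈fW , ≈ᴹ-sym (+ᴹ-identityˡ _))
             (λ _ x∈W (u , u∈W , x≈fu) → u , (u∈W , resp W x≈fu x∈W) , x≈fu) ⟩
      dim (W +ₛ fW) ℕ.+ dim (image f-homo W∩f⁻¹W)
        ≤⟨ ℕ.+-monoʳ-≤ _ (dim-image≤ f-homo W∩f⁻¹W (W⊆B ∘ proj₁)) ⟩
      dim (W +ₛ fW) ℕ.+ dim W∩f⁻¹W ∎
      where
      open ℕ.≤-Reasoning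
      f-homo = IsLeftModuleMonomorphism.isLeftModuleHomomorphism f-mono
      fW = image f-homo W
      W∩f⁻¹W = W ∩ₛ preimage f-homo W

    independent⇒spanning : ∀ xs → Independent xs → All (member B) xs → length gens ≤ length xs →
                           member B ⊆ member (span xs)
    independent⇒spanning xs ind xs∈B le {y} y∈B with y ∈? span xs
    ... | yes y∈ = y∈
    ... | no y∉ = contradiction (independent-length (y ∷ xs) (y∉ , ind) (y∈B ∷ xs∈B)) (ℕ.<⇒≱ (s≤s le))

    -- Rado's theorem in dual form: enlarging a family to independent hyperplanes.

    private
      variable
        n : ℕ

    -- For `W` inside `B` this is codimension at most one; in a family satisfying Hall's condition,
    -- the singletons exclude codimension zero.
    NearlyFull : Sub → Set _
    NearlyFull W = ∃[ x ] (member B ⊆ member (W +⟨ x ⟩))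

    -- For empty `J` this is the whole space, whose `dim` is that of `B` because only the part
    -- inside `B` is counted.
    ⋂[_] : Subset n → (Fin n → Sub) → Sub
    ⋂[ J ] W = ⋂ {∃[ i ] i Subset.∈ J} (W ∘ proj₁)

    -- Rado's condition dualised: the functionals on `B` vanishing on the part of some `W i` in `B`,
    -- with `i` in `J`, together span at least `∣ J ∣` dimensions.
    Hall : (Fin n → Sub) → Set
    Hall W = ∀ J → dim (⋂[ J ] W) ℕ.+ ∣ J ∣ ≤ dim B

    -- By submodularity, each intersection with a subspace of codimension at most one lowers the
    -- dimension by at most one.
    dim-⋂-nearlyFull : (W : Fin n → Sub) → (∀ i → member (W i) ⊆ member B) → (∀ i → NearlyFull (W i)) →
                       dim B ≤ dim (⋂ W) ℕ.+ n
    dim-⋂-nearlyFull {zero} W W⊆B full =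
      ≡.subst (dim B ≤_) (≡.sym (ℕ.+-identityʳ _)) (dim-mono B (⋂ W) (λ _ ()))
    dim-⋂-nearlyFull {suc n} W W⊆B full = begin
      dim B                     ≤⟨ dim-⋂-nearlyFull (W ∘ suc) (W⊆B ∘ suc) (full ∘ suc) ⟩
      dim ⋂tail ℕ.+ n           ≤⟨ ℕ.+-monoˡ-≤ n (ℕ.+-cancelʳ-≤ (dim (W zero)) _ _ step) ⟩
      suc (dim (⋂ W)) ℕ.+ n     ≡⟨ ℕ.+-suc _ n ⟨
      dim (⋂ W) ℕ.+ suc n       ∎
      where
      open ℕ.≤-Reasoning
      ⋂tail = ⋂ (W ∘ suc)
      step : dim ⋂tail ℕ.+ dim (W zero) ≤ suc (dim (⋂ W)) ℕ.+ dim (W zero)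
      step = begin
        dim ⋂tail ℕ.+ dim (W zero)       ≤⟨ dim-submodular ⋂tail (W zero) B (⋂ W) proj₂ proj₂
                                              (λ _ x∈tail x∈W₀ → λ { zero → x∈W₀ ; (suc i) → x∈tail i }) ⟩
        dim B ℕ.+ dim (⋂ W)
          ≤⟨ ℕ.+-monoˡ-≤ _ (dim-+⟨⟩ B (W zero) (proj₂ (full zero) ∘ proj₂) (W⊆B zero)) ⟩
        suc (dim (W zero)) ℕ.+ dim (⋂ W) ≡⟨ ≡.cong suc (ℕ.+-comm (dim (W zero)) _) ⟩
        suc (dim (⋂ W)) ℕ.+ dim (W zero) ∎

    module _ (W : Fin n → Sub) (hall : Hall W) (i : Fin n) where

      _[i]≔_ : Sub → Fin n → Sub
      _[i]≔_ U = updateAt W i (const U)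

      ⋂-update-other : (U : Sub) {J : Subset n} → x ∈ member (⋂[ J ] (_[i]≔_ U)) →
                       ∀ {j} → j Subset.∈ J → j ≢ i → x ∈ member (W j)
      ⋂-update-other U x∈ j∈J j≢i =
        ≡.subst (λ T → _ ∈ member T) (updateAt-minimal _ i W j≢i) (x∈ (_ , j∈J))

      ⋂-update-same : (U : Sub) {J : Subset n} → x ∈ member (⋂[ J ] (_[i]≔_ U)) →
                      i Subset.∈ J → x ∈ member U
      ⋂-update-same U x∈ i∈J = ≡.subst (λ T → _ ∈ member T) (updateAt-updates i W) (x∈ (i , i∈J))

      -- The subsets of a finite index set can be searched. A violating `J` contains `i`, as
      -- otherwise its intersection is that of the original family.
      hall-or-violated : (U : Sub) → Hall (_[i]≔_ U) ⊎
        (∃[ J ] (i Subset.∈ J × dim B < dim (⋂[ J ] (_[i]≔_ U)) ℕ.+ ∣ J ∣))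
      hall-or-violated U with anySubset? (λ J → dim B ℕ.<? dim (⋂[ J ] (_[i]≔_ U)) ℕ.+ ∣ J ∣)
      ... | no ¬violated = inj₁ (λ J → ℕ.≮⇒≥ (λ lt → ¬violated (J , lt)))
      ... | yes (J , lt) with i ∈ₛ? J
      ...   | yes i∈J = inj₂ (J , i∈J , lt)
      ...   | no i∉J = contradiction (ℕ.<-≤-trans lt (ℕ.+-monoˡ-≤ ∣ J ∣
        (dim-mono (⋂[ J ] (_[i]≔_ U)) (⋂[ J ] W)
          (λ (x∈ , _) (j , j∈J) → ⋂-update-other U x∈ j∈J (λ { ≡.refl → i∉J j∈J })))))
        (ℕ.≤⇒≯ (hall J))

      -- Uncrossing: two violating index sets J, J′ would violate the condition at J ∪ J′ or (J ∩ J′) - i.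
      hall-enlarge : (P Q : Sub) → member (P ∩ₛ Q) ⊆ member (W i) → Hall (_[i]≔_ P) ⊎ Hall (_[i]≔_ Q)
      hall-enlarge P Q P∩Q⊆Wi with hall-or-violated P | hall-or-violated Q
      ... | inj₁ h | _      = inj₁ h
      ... | _      | inj₁ h = inj₂ h
      ... | inj₂ (J , i∈J , ltP) | inj₂ (J′ , i∈J′ , ltQ) =
        uncrossing-count {p = dim P[J]} {q = dim Q[J′]} {s = dim (⋂[ I ] W)} {t = dim (⋂[ J ∪ J′ ] W)}
          {j = ∣ J ∣} {j′ = ∣ J′ ∣} {k = ∣ I ∣} {k∪ = ∣ J ∪ J′ ∣}
          ltP ltQ submodular (∣p∪q∣+∣p∩q∣≡∣p∣+∣q∣ J J′) (∣p∣≤1+∣p-x∣ (J ∩ J′) i) (hall I) (hall (J ∪ J′))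
        where
        P[J] = ⋂[ J ] (_[i]≔_ P)
        Q[J′] = ⋂[ J′ ] (_[i]≔_ Q)
        -- `i` is left out because there the altered families give membership in `P` or `Q`, not in
        -- `W i`. The loss of one is covered by both violations being strict.
        I = (J ∩ J′) Subset.- i

        ∈∪ : x ∈ member P[J] → x ∈ member Q[J′] → x ∈ member (⋂[ J ∪ J′ ] W)
        ∈∪ x∈P x∈Q (j , j∈) with j Fin.≟ i
        ... | yes ≡.refl = P∩Q⊆Wi (⋂-update-same P x∈P i∈J , ⋂-update-same Q x∈Q i∈J′)
        ... | no j≢i with x∈p∪q⁻ J J′ j∈
        ...   | inj₁ j∈J  = ⋂-update-other P x∈P j∈J j≢i
        ...   | inj₂ j∈J′ = ⋂-update-other Q x∈Q j∈J′ j≢i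

        j∈I⇒ : ∀ {j} → j Subset.∈ I → (j Subset.∈ J × j Subset.∈ J′) × j ≢ i
        j∈I⇒ j∈I = x∈p∩q⁻ J J′ (p─q⊆p (J ∩ J′) Subset.⁅ i ⁆ j∈I) , λ { ≡.refl → x∉p-x (J ∩ J′) i j∈I }

        submodular : dim P[J] ℕ.+ dim Q[J′] ≤ dim (⋂[ I ] W) ℕ.+ dim (⋂[ J ∪ J′ ] W)
        submodular = dim-submodular P[J] Q[J′] (⋂[ I ] W) (⋂[ J ∪ J′ ] W)
          (λ (x∈ , _) (j , j∈I) → let (j∈J , _) , j≢i = j∈I⇒ j∈I in ⋂-update-other P x∈ j∈J j≢i)
          (λ (x∈ , _) (j , j∈I) → let (_ , j∈J′) , j≢i = j∈I⇒ j∈I in ⋂-update-other Q x∈ j∈J′ j≢i)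
          (λ _ → ∈∪)

    -- A vector `z` of the intersection outside `W` could be exchanged for `y`, putting `y` into
    -- `W +⟨ z ⟩` and so into `W +⟨ x ⟩`.
    +⟨⟩∩+⟨⟩⊆ : (W : Sub) → y ∉ member (W +⟨ x ⟩) → member ((W +⟨ x ⟩) ∩ₛ (W +⟨ y ⟩)) ⊆ member W
    +⟨⟩∩+⟨⟩⊆ {y} {x} W y∉ {z} (z∈W+x , z∈W+y) with z ∈? W
    ... | yes z∈W = z∈W
    ... | no z∉W = contradiction
      (+⟨⟩-least {U = W} (W +⟨ x ⟩) (⊆+⟨⟩ W) z∈W+x (+⟨⟩-exchange W z∈W+y z∉W (∈+⟨⟩ W))) y∉

    nearlyFull-mono : (P Q : Sub) → member P ⊆ member Q → NearlyFull P → NearlyFull Q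
    nearlyFull-mono P Q P⊆Q (x , B⊆) = x , +⟨⟩-mono P Q P⊆Q ∘ B⊆

    record HallFamily (n : ℕ) : Set (Level.suc ℓ) where
      field
        family : Fin n → Sub
        ⊆B     : ∀ i → member (family i) ⊆ member B
        hall   : Hall family

    open HallFamily

    _≼_ : HallFamily n → HallFamily n → Set _
    F ≼ G = ∀ i → member (family F i) ⊆ member (family G i)

    -- The strict growth of the dimension at `i` is what makes repeated enlargement terminate.
    adjoinAt : (F : HallFamily n) (i : Fin n) (z : Carrierᴹ) → z ∈ member B → z ∉ member (family F i) →
      Hall (updateAt (family F) i (const (family F i +⟨ z ⟩))) →
      Σ[ G ∈ HallFamily n ] (F ≼ G × dim (family F i) < dim (family G i))
    adjoinAt F i z z∈B z∉Fi h = G , F≼G , ℕ.≰⇒> λ le →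
        z∉Fi (dim≤⇒⊆ (family F i) (family G i) (F≼G i) (⊆B G i) le z∈Gi)
      where
      Fi+z = family F i +⟨ z ⟩
      F′ = updateAt (family F) i (const Fi+z)

      F′i≡ : F′ i ≡ Fi+z
      F′i≡ = updateAt-updates i (family F)

      F′j⊆B : ∀ j → member (F′ j) ⊆ member B
      F′j⊆B j with j Fin.≟ i
      ... | yes ≡.refl = ≡.subst (λ T → member T ⊆ member B) (≡.sym F′i≡)
                           (+⟨⟩-least {U = family F i} B (⊆B F i) z∈B)
      ... | no j≢i     = ≡.subst (λ T → member T ⊆ member B) (≡.sym (updateAt-minimal j i (family F) j≢i)) (⊆B F j)

      G = record { family = F′ ; ⊆B = F′j⊆B ; hall = h }

      F≼G : F ≼ G
      F≼G j with j Fin.≟ i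
      ... | yes ≡.refl = ≡.subst (λ T → member (family F i) ⊆ member T) (≡.sym F′i≡) (⊆+⟨⟩ (family F i))
      ... | no j≢i     = ≡.subst (λ T → member (family F j) ⊆ member T)
                           (≡.sym (updateAt-minimal j i (family F) j≢i)) (λ x∈ → x∈)

      z∈Gi : z ∈ member (F′ i)
      z∈Gi = ≡.subst (λ T → z ∈ member T) (≡.sym F′i≡) (∈+⟨⟩ (family F i))

    -- Rado's reduction, in dual form: a subspace that is not yet nearly full can be enlarged in two
    -- directions meeting only in itself, and by uncrossing one of them preserves Hall's condition.
    fillAt : (k : ℕ) (i : Fin n) (F : HallFamily n) → dim B ≤ dim (family F i) ℕ.+ k →
      Σ[ G ∈ HallFamily n ] (F ≼ G × NearlyFull (family G i))
    fillAt k i F bound with ∃∉-or-⊆ B (family F i)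
    ... | inj₂ B⊆Fi = F , (λ _ z∈ → z∈) , 0ᴹ , ⊆+⟨⟩ (family F i) ∘ B⊆Fi
    ... | inj₁ (x , x∈B , x∉) with ∃∉-or-⊆ B (family F i +⟨ x ⟩)
    ...   | inj₂ B⊆Fi+x = F , (λ _ z∈ → z∈) , x , B⊆Fi+x
    -- `k` bounds the codimension of `family F i` in `B`, and each enlargement uses up one unit. At
    -- `zero` the subspace is all of `B`, so no such `x` is left.
    fillAt zero i F bound | inj₁ (x , x∈B , x∉) | inj₁ _ = contradiction
      (dim≤⇒⊆ (family F i) B (⊆B F i) (λ z∈ → z∈) (≡.subst (dim B ≤_) (ℕ.+-identityʳ _) bound) x∈B) x∉
    fillAt {n} (suc k) i F bound | inj₁ (x , x∈B , x∉) | inj₁ (y , y∈B , y∉) = fill grown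
      where
      grown : Σ[ G ∈ HallFamily n ] (F ≼ G × dim (family F i) < dim (family G i))
      grown with hall-enlarge (family F) (hall F) i
                   (family F i +⟨ x ⟩) (family F i +⟨ y ⟩) (+⟨⟩∩+⟨⟩⊆ (family F i) y∉)
      ... | inj₁ h = adjoinAt F i x x∈B x∉ h
      ... | inj₂ h = adjoinAt F i y y∈B (y∉ ∘ ⊆+⟨⟩ (family F i)) h

      fill : Σ[ G ∈ HallFamily n ] (F ≼ G × dim (family F i) < dim (family G i)) →
             Σ[ G ∈ HallFamily n ] (F ≼ G × NearlyFull (family G i))
      fill (G , F≼G , lt) with fillAt k i G (ℕ.≤-trans bound
        (ℕ.≤-trans (ℕ.≤-reflexive (ℕ.+-suc _ k)) (ℕ.+-monoˡ-≤ k lt)))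
      ... | H , G≼H , full = H , (λ j → G≼H j ∘ F≼G j) , full

    fillAll : (is : List (Fin n)) (F : HallFamily n) →
      Σ[ G ∈ HallFamily n ] (F ≼ G × All (NearlyFull ∘ family G) is)
    fillAll []       F = F , (λ _ z∈ → z∈) , []
    fillAll (i ∷ is) F with fillAll is F
    ... | G , F≼G , full with fillAt (dim B) i G (ℕ.m≤n+m (dim B) _)
    ...   | H , G≼H , fullᵢ = H , (λ j → G≼H j ∘ F≼G j) ,
      fullᵢ ∷ All.map (λ {j} → nearlyFull-mono (family G j) (family H j) (G≼H j)) full

    -- With `suc n` nearly full subspaces, those other than the one at `i` meet in dimension at
    -- least `dim B - n`, while Hall's condition at the full index set bounds the whole intersection
    -- by `dim B - (n + 1)`. Hence some vector lies in all the others but not in the one at `i`.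
    transversal : (F : HallFamily n) →
      Σ[ G ∈ HallFamily n ] (F ≼ G × Σ[ b ∈ Vector Carrierᴹ n ] (∀ i → b i ∈ member B ×
        (∀ j → i ≢ j → b i ∈ member (family G j)) × b i ∉ member (family G i)))
    transversal {zero}  F = F , (λ _ x∈ → x∈) , (λ ()) , (λ ())
    transversal {suc n} F with fillAll (allFin (suc n)) F
    ... | G , F≼G , full = G , F≼G , proj₁ ∘ chosen , proj₂ ∘ chosen
      where
      H = family G

      chosen : ∀ i → ∃[ b ] (b ∈ member B × (∀ j → i ≢ j → b ∈ member (H j)) × b ∉ member (H i))
      chosen i with ∃∉-or-⊆ (⋂ (H ∘ punchIn i) ∩ₛ B) (H i)
      ... | inj₁ (b , (b∈ , b∈B) , b∉) = b , b∈B ,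
        (λ j i≢j → ≡.subst (λ k → b ∈ member (H k)) (punchIn-punchOut i≢j) (b∈ (punchOut i≢j))) , b∉
      ... | inj₂ ⊆Hi = contradiction many (ℕ.<⇒≱ few)
        where
        open ℕ.≤-Reasoning
        ⊆⋂⊤ : member (⋂ (H ∘ punchIn i) ∩ₛ B) ⊆ member (⋂[ Subset.⊤ ] H)
        ⊆⋂⊤ x∈ (j , _) with i Fin.≟ j
        ... | yes ≡.refl = ⊆Hi x∈
        ... | no i≢j = ≡.subst (λ k → _ ∈ member (H k)) (punchIn-punchOut i≢j) (proj₁ x∈ (punchOut i≢j))

        many : dim B ≤ dim (⋂[ Subset.⊤ ] H) ℕ.+ n
        many = ℕ.≤-trans
          (dim-⋂-nearlyFull (H ∘ punchIn i) (⊆B G ∘ punchIn i) (All.tabulate⁻ {f = λ j → j} full ∘ punchIn i))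
          (ℕ.+-monoˡ-≤ n (dim-mono (⋂ (H ∘ punchIn i)) (⋂[ Subset.⊤ ] H) ⊆⋂⊤))

        few : dim (⋂[ Subset.⊤ ] H) ℕ.+ n < dim B
        few = begin
          suc (dim (⋂[ Subset.⊤ ] H) ℕ.+ n)                  ≡⟨ ℕ.+-suc _ n ⟨
          dim (⋂[ Subset.⊤ ] H) ℕ.+ suc n
            ≡⟨ ≡.cong (dim (⋂[ Subset.⊤ ] H) ℕ.+_) (∣⊤∣≡n (suc n)) ⟨
          dim (⋂[ Subset.⊤ ] H) ℕ.+ ∣ Subset.⊤ {suc n} ∣     ≤⟨ hall G Subset.⊤ ⟩
          dim B                                              ∎

-- Multiplication by a fixed element as a `K`-linear map.

module CentralExtensionProperties {k ℓk l ℓl : Level} {K : CommutativeRing k ℓk} {L : Ring l ℓl}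
  (E : CentralExtension K L) where

  open Ring L
  open RingProperties L using (-‿distribˡ-*; -‿distribʳ-*)
  open CentralExtension E
  open IsDivisionRing L-isDivisionRing
  open LeftModuleMorphisms (LeftModule.rawLeftModule leftModule) (LeftModule.rawLeftModule leftModule)
    using (IsLeftModuleHomomorphism; IsLeftModuleMonomorphism)
  open SetoidReasoning setoid

  *-cancelˡ : ∀ {e} x y → ¬ e ≈ 0# → e * x ≈ e * y → x ≈ y
  *-cancelˡ {e} x y e≉0 ex≈ey with inverse e e≉0
  ... | e⁻¹ , e⁻¹e≈1 , _ = begin
    x              ≈⟨ e⁻¹ez≈z x ⟨
    e⁻¹ * (e * x)  ≈⟨ *-congˡ ex≈ey ⟩
    e⁻¹ * (e * y)  ≈⟨ e⁻¹ez≈z y ⟩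
    y              ∎
    where
    e⁻¹ez≈z : ∀ z → e⁻¹ * (e * z) ≈ z
    e⁻¹ez≈z z = trans (sym (*-assoc e⁻¹ e z)) (trans (*-congʳ e⁻¹e≈1) (*-identityˡ z))

  *-cancelʳ : ∀ {e} x y → ¬ e ≈ 0# → x * e ≈ y * e → x ≈ y
  *-cancelʳ {e} x y e≉0 xe≈ye with inverse e e≉0
  ... | e⁻¹ , _ , ee⁻¹≈1 = begin
    x              ≈⟨ zee⁻¹≈z x ⟨
    (x * e) * e⁻¹  ≈⟨ *-congʳ xe≈ye ⟩
    (y * e) * e⁻¹  ≈⟨ zee⁻¹≈z y ⟩
    y              ∎
    where
    zee⁻¹≈z : ∀ z → (z * e) * e⁻¹ ≈ z
    zee⁻¹≈z z = trans (*-assoc z e e⁻¹) (trans (*-congˡ ee⁻¹≈1) (*-identityʳ z))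

  *ˡ-isHomomorphism : ∀ e → IsLeftModuleHomomorphism (e *_)
  *ˡ-isHomomorphism e = record
    { +ᴹ-isGroupHomomorphism = record
      { isMonoidHomomorphism = record
        { isMagmaHomomorphism = record
          { isRelHomomorphism = record { cong = *-congˡ }
          ; homo = distribˡ e
          }
        ; ε-homo = zeroʳ e
        }
      ; ⁻¹-homo = λ x → sym (-‿distribʳ-* e x)
      }
    -- Centrality of `K` moves the scalar `ι c` past `e`.
    ; *ₗ-homo = λ c x → begin
        e * (ι c * x) ≈⟨ *-assoc e (ι c) x ⟨
        (e * ι c) * x ≈⟨ *-congʳ (ι-central c e) ⟨
        (ι c * e) * x ≈⟨ *-assoc (ι c) e x ⟩
        ι c * (e * x) ∎
    }

  *ʳ-isHomomorphism : ∀ e → IsLeftModuleHomomorphism (_* e)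
  *ʳ-isHomomorphism e = record
    { +ᴹ-isGroupHomomorphism = record
      { isMonoidHomomorphism = record
        { isMagmaHomomorphism = record
          { isRelHomomorphism = record { cong = *-congʳ }
          ; homo = distribʳ e
          }
        ; ε-homo = zeroˡ e
        }
      ; ⁻¹-homo = λ x → sym (-‿distribˡ-* x e)
      }
    ; *ₗ-homo = λ c x → *-assoc (ι c) x e
    }

  *ˡ-isMonomorphism : ∀ {e} → ¬ e ≈ 0# → IsLeftModuleMonomorphism (e *_)
  *ˡ-isMonomorphism {e} e≉0 = record
    { isLeftModuleHomomorphism = *ˡ-isHomomorphism e
    ; injective = *-cancelˡ _ _ e≉0
    }

  *ʳ-isMonomorphism : ∀ {e} → ¬ e ≈ 0# → IsLeftModuleMonomorphism (_* e)
  *ʳ-isMonomorphism {e} e≉0 = record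
    { isLeftModuleHomomorphism = *ʳ-isHomomorphism e
    ; injective = *-cancelʳ _ _ e≉0
    }

-- The dimension bound for two subspaces with products inside `B`.

module ProductBound {k ℓk l ℓl p : Level} {K : CommutativeRing k ℓk} {L : Ring l ℓl}
  (E : CentralExtension K L) (em : ExcludedMiddle (k ⊔ ℓk ⊔ l ⊔ ℓl ⊔ p)) where

  open Ring L
  open CentralExtension E using (leftModule; K-isDivisionRing)
  open CentralExtensionProperties E
  open FiniteDimension {p = p} leftModule K-isDivisionRing em
  open LinearAlgebra leftModule
  open Subspace using (resp; +-closed)

  module _ (B : Sub) (gens : List Carrier) (B⊆gens : member B ⊆ member (span gens))
    (1∉B : 1# ∉ member B) where

    open Dimension B gens B⊆gens

    -- Otherwise `eC` would lie in `C` and equal it for dimension reasons; then `e = e c` with `c`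
    -- in `C`, so `c = 1` would lie in `B`.
    dim∩e⁻¹<dim : (C : Sub) → member C ⊆ member B → ∀ {e} → e ∈ member C → ¬ e ≈ 0# →
      dim (C ∩ₛ preimage (*ˡ-isHomomorphism e) C) < dim C
    dim∩e⁻¹<dim C C⊆B {e} e∈C e≉0 = ℕ.≰⇒> λ le →
      let eC = image (*ˡ-isHomomorphism e) C
          eC⊆C : member eC ⊆ member C
          eC⊆C = λ (c , c∈C , x≈ec) → resp C (sym x≈ec)
            (proj₂ (dim≤⇒⊆ (C ∩ₛ preimage (*ˡ-isHomomorphism e) C) C proj₁ C⊆B le c∈C))
          dimC≤dimeC = dim-mono-map (*ˡ-isMonomorphism e≉0) C eC
            (λ (x∈C , _) → (_ , x∈C , refl) , C⊆B (eC⊆C (_ , x∈C , refl)))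
          c , c∈C , e≈ec = dim≤⇒⊆ eC C eC⊆C C⊆B dimC≤dimeC e∈C
          c≈1 = *-cancelˡ c 1# e≉0 (trans (sym e≈ec) (sym (*-identityʳ e)))
      in 1∉B (C⊆B (resp C c≈1 c∈C))

    -- Lexicographic descent: g bounds the room left for dim A + dim C, and h bounds dim C.
    dim+dim≤dim : (g h : ℕ) (A C : Sub) → member A ⊆ member B → member C ⊆ member B →
      (∀ {x y} → x ∈ member A → y ∈ member C → (x * y) ∈ member B) →
      dim B ℕ.+ dim B ≤ dim A ℕ.+ dim C ℕ.+ g → dim C ≤ h → dim A ℕ.+ dim C ≤ dim B
    dim+dim≤dim g h A C A⊆B C⊆B AC⊆B room dimC≤h with ∃∉-or-⊆ (A ∩ₛ C) 0ₛ
    ... | inj₂ A∩C⊆0 = begin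
      dim A ℕ.+ dim C   ≤⟨ dim-submodular A C B 0ₛ proj₂ proj₂ (λ _ x∈A x∈C → A∩C⊆0 (x∈A , x∈C)) ⟩
      dim B ℕ.+ dim 0ₛ  ≡⟨ ≡.cong (dim B ℕ.+_) (dim-zero 0ₛ (lower ∘ proj₁)) ⟩
      dim B ℕ.+ 0       ≡⟨ ℕ.+-identityʳ (dim B) ⟩
      dim B             ∎
      where open ℕ.≤-Reasoning
    ... | inj₁ (e , (e∈A , e∈C) , e∉0) = descend (dim A ℕ.+ dim C ℕ.≤? dim A′ ℕ.+ dim C′) g h room dimC≤h
      where
      e≉0 : ¬ e ≈ 0#
      e≉0 = e∉0 ∘ lift

      -- The two transforms of the pair by `e`. The enlarged factors stay in `B` since `e` is in
      -- both `A` and `C`; the shrunken ones keep what `(a e) c = a (e c)` needs for the products to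
      -- stay in `B`.
      Ae = image (*ʳ-isHomomorphism e) A
      eC = image (*ˡ-isHomomorphism e) C
      A′ = A +ₛ Ae
      C′ = C ∩ₛ preimage (*ˡ-isHomomorphism e) C
      A″ = A ∩ₛ preimage (*ʳ-isHomomorphism e) A
      C″ = C +ₛ eC

      A′⊆B : member A′ ⊆ member B
      A′⊆B (_ , _ , u∈A , (a , a∈A , v≈ae) , x≈u+v) =
        resp B (sym x≈u+v) (+-closed B (A⊆B u∈A) (resp B (sym v≈ae) (AC⊆B a∈A e∈C)))

      C″⊆B : member C″ ⊆ member B
      C″⊆B (_ , _ , u∈C , (c , c∈C , v≈ec) , x≈u+v) =
        resp B (sym x≈u+v) (+-closed B (C⊆B u∈C) (resp B (sym v≈ec) (AC⊆B e∈A c∈C)))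

      A′C′⊆B : ∀ {x y} → x ∈ member A′ → y ∈ member C′ → (x * y) ∈ member B
      A′C′⊆B {y = y} (u , v , u∈A , (a , a∈A , v≈ae) , x≈u+v) (y∈C , ey∈C) =
        resp B (sym (trans (*-congʳ x≈u+v) (distribʳ y u v)))
          (+-closed B (AC⊆B u∈A y∈C) (resp B (sym (trans (*-congʳ v≈ae) (*-assoc a e y))) (AC⊆B a∈A ey∈C)))

      A″C″⊆B : ∀ {x y} → x ∈ member A″ → y ∈ member C″ → (x * y) ∈ member B
      A″C″⊆B {x} (x∈A , xe∈A) (u , v , u∈C , (c , c∈C , v≈ec) , y≈u+v) =
        resp B (sym (trans (*-congˡ y≈u+v) (distribˡ x u v)))
          (+-closed B (AC⊆B x∈A u∈C) (resp B (sym (trans (*-congˡ v≈ec) (sym (*-assoc x e c)))) (AC⊆B xe∈A c∈C)))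

      average : (dim A ℕ.+ dim C) ℕ.+ (dim A ℕ.+ dim C) ≤ (dim A′ ℕ.+ dim C′) ℕ.+ (dim A″ ℕ.+ dim C″)
      average = begin
        (dim A ℕ.+ dim C) ℕ.+ (dim A ℕ.+ dim C)
          ≡⟨ interchange (dim A) (dim C) (dim A) (dim C) ⟩
        (dim A ℕ.+ dim A) ℕ.+ (dim C ℕ.+ dim C)
          ≤⟨ ℕ.+-mono-≤ (2dim≤dim+∩ (*ʳ-isMonomorphism e≉0) A A⊆B (λ x∈A → AC⊆B x∈A e∈C))
                        (2dim≤dim+∩ (*ˡ-isMonomorphism e≉0) C C⊆B (AC⊆B e∈A)) ⟩
        (dim A′ ℕ.+ dim A″) ℕ.+ (dim C″ ℕ.+ dim C′)
          ≡⟨ ≡.cong (dim A′ ℕ.+ dim A″ ℕ.+_) (ℕ.+-comm (dim C″) (dim C′)) ⟩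
        (dim A′ ℕ.+ dim A″) ℕ.+ (dim C′ ℕ.+ dim C″)
          ≡⟨ interchange (dim A′) (dim A″) (dim C′) (dim C″) ⟩
        (dim A′ ℕ.+ dim C′) ℕ.+ (dim A″ ℕ.+ dim C″) ∎
        where
        open ℕ.≤-Reasoning
        open CommutativeSemigroupProperties ℕ.+-commutativeSemigroup using (interchange)

      dim≤dimB : (W : Sub) → dim W ≤ dim B
      dim≤dimB W = dim-mono W B proj₂

      -- If the first transform does not lower the sum, pass to it: `h` drops because `C′` is
      -- smaller than `C`. Otherwise `average` makes the second sum strictly larger, so `g` drops
      -- and `h` restarts at `dim B`.
      descend : Dec (dim A ℕ.+ dim C ≤ dim A′ ℕ.+ dim C′) → ∀ g h →
        dim B ℕ.+ dim B ≤ dim A ℕ.+ dim C ℕ.+ g → dim C ≤ h → dim A ℕ.+ dim C ≤ dim B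
      descend (yes le) g zero room dimC≤h =
        contradiction (ℕ.<-≤-trans (dim∩e⁻¹<dim C C⊆B e∈C e≉0) dimC≤h) λ ()
      descend (yes le) g (suc h) room dimC≤h = ℕ.≤-trans le
        (dim+dim≤dim g h A′ C′ A′⊆B (C⊆B ∘ proj₁) A′C′⊆B
          (ℕ.≤-trans room (ℕ.+-monoˡ-≤ g le))
          (ℕ.≤-pred (ℕ.<-≤-trans (dim∩e⁻¹<dim C C⊆B e∈C e≉0) dimC≤h)))
      descend (no ≰) g h room dimC≤h = bigger g room
        where
        lt : dim A ℕ.+ dim C < dim A″ ℕ.+ dim C″
        lt = ℕ.≰⇒> λ le → ℕ.<⇒≱ (ℕ.+-mono-<-≤ (ℕ.≰⇒> ≰) le) average

        bigger : ∀ g → dim B ℕ.+ dim B ≤ dim A ℕ.+ dim C ℕ.+ g → dim A ℕ.+ dim C ≤ dim B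
        -- With no room left the sum is already `2 dim B`, so the strictly larger second sum is
        -- impossible.
        bigger zero room = contradiction
          (ℕ.+-mono-≤ (dim≤dimB A″) (dim≤dimB C″))
          (ℕ.<⇒≱ (ℕ.≤-<-trans (≡.subst (dim B ℕ.+ dim B ≤_) (ℕ.+-identityʳ _) room) lt))
        bigger (suc g) room = ℕ.≤-trans (ℕ.<⇒≤ lt)
          (dim+dim≤dim g (dim B) A″ C″ (A⊆B ∘ proj₁) C″⊆B A″C″⊆B
            (ℕ.≤-trans room (ℕ.≤-trans (ℕ.≤-reflexive (ℕ.+-suc _ g)) (ℕ.+-monoˡ-≤ g lt)))
            (dim≤dimB C″))

-- Matching of bases: the two implications.

module MatchedSubspace {k ℓk l ℓl p : Level} {K : CommutativeRing k ℓk} {L : Ring l ℓl}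
  (E : CentralExtension K L) (em : ExcludedMiddle (k ⊔ ℓk ⊔ l ⊔ ℓl ⊔ p))
  (B : Matching.Subspace E p) {n : ℕ} (v : Vector (Ring.Carrier L) n) (v-basis : Matching.IsBasis E B v) where

  open Ring L
  open CentralExtension E using (leftModule; K-isDivisionRing; L-isDivisionRing)
  open CentralExtensionProperties E
  open FiniteDimension {p = p} leftModule K-isDivisionRing em
  open Matching E
  open Subspace using (resp; 0-closed; +-closed; *ₗ-closed)
  open IsBasis

  matched⇒1∉B : Matched n B B → ¬ (1# ∈ member B)
  matched⇒1∉B matched 1∈B with matched v v-basis
  ... | b , b-basis , b-matched with spanning b-basis 1∈B
  ...   | c , 1≈lc = IsDivisionRing.1≉0 L-isDivisionRing (trans 1≈lc (linearCombination-0 c b c≈0))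
    where
    c≈0 : ∀ i → CommutativeRing._≈_ K (c i) (CommutativeRing.0# K)
    c≈0 i = coordinate≈0 (span (tabulate (omit b i))) c b i (∈-span-omit b i)
      (independent⇒∉Span-omit b (independent b-basis) i ∘ span⇒Span (omit b i))
      (resp (span (tabulate (omit b i))) 1≈lc (Span⇒span (omit b i)
        -- Matching is applied to the vector `1#`, for which `v i * 1#` is `v i` itself.
        (b-matched i 1∈B (resp B (sym (*-identityʳ (v i))) (inSubspace v-basis i)))))

  -- `B` raised to the level of `Sub`, with the same elements.
  B↑ : Sub
  B↑ = record
    { member    = λ x → Lift (k ⊔ ℓk ⊔ l ⊔ ℓl ⊔ p) (x ∈ member B)
    ; resp      = λ x≈y (lift x∈B) → lift (resp B x≈y x∈B)
    ; 0-closed  = lift (0-closed B)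
    ; +-closed  = λ (lift x∈B) (lift y∈B) → lift (+-closed B x∈B y∈B)
    ; *ₗ-closed = λ c (lift x∈B) → lift (*ₗ-closed B c x∈B)
    }

  B⊆v : member B↑ ⊆ member (span (tabulate v))
  B⊆v (lift x∈B) = Span⇒span v (spanning v-basis x∈B)

  open Dimension B↑ (tabulate v) B⊆v

  module _ (1∉B : ¬ (1# ∈ member B)) (a : Vector Carrier n) (a-basis : IsBasis B a) where

    -- The vectors that matching requires to lie in the span of the `b j` with `j` different from
    -- `i`.
    W : Fin n → Sub
    W i = preimage (*ˡ-isHomomorphism (a i)) B↑ ∩ₛ B↑

    -- The `a i` with `i` in `J` span a subspace of dimension at least `∣ J ∣` that multiplies the
    -- intersection into `B`, so the product bound applies; `1∉B` enters here.
    hall : Hall W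
    hall J = begin
      dim (⋂[ J ] W) ℕ.+ ∣ J ∣ ≡⟨ ℕ.+-comm _ ∣ J ∣ ⟩
      ∣ J ∣ ℕ.+ dim (⋂[ J ] W) ≤⟨ ℕ.+-mono-≤ ∣J∣≤dimA (dim-mono (⋂[ J ] W) C (λ x∈ → x∈)) ⟩
      -- Both counters of the descent start at values for which their bounds are trivial.
      dim A ℕ.+ dim C          ≤⟨ ProductBound.dim+dim≤dim E em B↑ (tabulate v) B⊆v (1∉B ∘ lower)
                                    (dim B↑ ℕ.+ dim B↑) (dim C) A C A⊆B proj₂ AC⊆B
                                    (ℕ.m≤n+m _ (dim A ℕ.+ dim C)) ℕ.≤-refl ⟩
      dim B↑                   ∎
      where
      open ℕ.≤-Reasoning
      A = span (select J a)
      -- Cutting down to `B↑` matters for empty `J`, where `⋂[ J ] W` is all of `L`.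
      C = ⋂[ J ] W ∩ₛ B↑

      A⊆B : member A ⊆ member B↑
      A⊆B = span-least B↑ (select⁺ J (λ {i} _ → lift (inSubspace a-basis i)))

      AC⊆B : ∀ {x y} → x ∈ member A → y ∈ member C → (x * y) ∈ member B↑
      AC⊆B {y = y} x∈A (y∈W , _) =
        span-least (preimage (*ʳ-isHomomorphism y) B↑) (select⁺ J (λ {i} i∈J → proj₁ (y∈W (i , i∈J)))) x∈A

      ∣J∣≤dimA : ∣ J ∣ ≤ dim A
      ∣J∣≤dimA = ≡.subst (_≤ dim A) (length-select J a)
        (independent⇒≤dim A (independent-select J a (independent-tabulate a (independent a-basis)))
          (All.map (λ x∈A → x∈A , A⊆B x∈A) (∈-span (select J a))))

    family : HallFamily n
    family = record { family = W ; ⊆B = λ _ → proj₂ ; hall = hall }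

  -- `b i` lies outside `H i` and every other `b j` inside, so a combination lying in `H i` has zero
  -- coefficient at `i`. This gives independence of `b`, then spanning by counting, and finally
  -- matching, since `H i` contains the vectors of `B` that `a i` multiplies into `B`.
  1∉B⇒matched : ¬ (1# ∈ member B) → Matched n B B
  1∉B⇒matched 1∉B a a-basis with transversal (family 1∉B a a-basis)
  ... | G , W⊆G , b , b-props = b , b-basis , b-matched
    where
    H = HallFamily.family G

    coordinate : ∀ c i → linearCombination c b ∈ member (H i) → CommutativeRing._≈_ K (c i) (CommutativeRing.0# K)
    coordinate c i = coordinate≈0 (H i) c b i
      (λ j j≢i → proj₁ (proj₂ (b-props j)) i j≢i) (proj₂ (proj₂ (b-props i)))

    b-independent : LinearlyIndependent b
    b-independent c lc≈0 i = coordinate c i (resp (H i) (sym lc≈0) (0-closed (H i)))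

    B⊆b : member B ⊆ Span b
    B⊆b x∈B = span⇒Span b (independent⇒spanning (tabulate b) (independent-tabulate b b-independent)
      (All.tabulate⁺ (λ i → proj₁ (b-props i)))
      (ℕ.≤-reflexive (≡.trans (length-tabulate v) (≡.sym (length-tabulate b)))) (lift x∈B))

    b-basis : IsBasis B b
    b-basis = record
      { inSubspace  = λ i → lower (proj₁ (b-props i))
      ; independent = b-independent
      ; spanning    = B⊆b
      }

    b-matched : BasisMatched B B a b
    b-matched i x∈B aᵢx∈B with B⊆b x∈B
    ... | c , x≈lc with ∈-Span-omit c b i (coordinate c i (resp (H i) x≈lc (W⊆G i (lift aᵢx∈B , lift x∈B))))
    ...   | d , lc≈ = d , trans x≈lc lc≈

theorem2p8 : ∀ {k ℓk l ℓl p : Level} →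
    ExcludedMiddle (k ⊔ ℓk ⊔ l ⊔ ℓl ⊔ p) →
    (K : CommutativeRing k ℓk) (L : Ring l ℓl) (E : CentralExtension K L) →
    let open Matching E in
    (B : Subspace p) (n : ℕ) → HasDimension B n →
    Matched n B B ⇔ (¬ (Ring.1# L ∈ member B))
theorem2p8 {k} {ℓk} {l} {ℓl} {p} em K L E B n (v , v-basis) = mk⇔ matched⇒1∉B 1∉B⇒matched
  where open MatchedSubspace {p = p} E em B v v-basis
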